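{- There exists a finite convex geometry $(X,\varphi)$ of convex dimension exactly $3$ such that, for every integer $t\ge 1$, $(X,\varphi)$ is not representable by spheres in $\mathbb{R}^t$.
   Context: A closure operator on a set $X$ is a map $\varphi:2^X\to 2^X$ with $Y\subseteq\varphi(Y)$, $Y\subseteq Z\Rightarrow\varphi(Y)\subseteq\varphi(Z)$, and $\varphi(\varphi(Y))=\varphi(Y)$; a subset $Y$ is closed if $\varphi(Y)=Y$. The family $\mathcal{F}_\varphi$ of closed sets is the closure space of $\varphi$ (a family of subsets of $X$ containing $X$ and closed under pairwise intersections; for finite $X$, closure operators and closure spaces determine each other). The pair $(X,\varphi)$, $X$ finite, is a convex geometry if $\varphi(\emptyset)=\emptyset$ and the Anti-Exchange Property holds: for every closed $Y\subseteq X$ and distinct $x,y\in X\setminus Y$, if $x\in\varphi(Y\cup\{y\})$ then $y\notin\varphi(Y\cup\{x\})$. A convex geometry is monotone if its closed sets form a chain under inclusion; equivalently its closed sets are exactly $\emptyset\subset\{x_1\}\subset\{x_1,x_2\}\subset\dots\subset\{x_1,\dots,x_n\}=X$ for some linear order $x_1<\dots<x_n$ of $X$. The join $\mathcal{F}\vee\mathcal{K}$ of two closure spaces on $X$ is the smallest closure space containing both; it equals $\{F\cap K: F\in\mathcal{F},K\in\mathcal{K}\}$. The convex dimension of a convex geometry $(X,\varphi)$ is the least $k$ such that $\mathcal{F}_\varphi$ is the join of $k$ monotone convex geometries on $X$. "Sphere in $\mathbb{R}^t$" means a closed (solid) Euclidean ball of radius $\ge 0$ (radius $0$ gives a point). Let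 $\mathrm{CH}$ denote the usual convex hull in $\mathbb{R}^t$. A finite convex geometry $(X,\varphi)$ is representable by spheres in $\mathbb{R}^t$ if there is an injective assignment $x\mapsto F(x)$ of spheres in $\mathbb{R}^t$ to the elements of $X$ such that for all $Y\subseteq X$, $\varphi(Y)=\{x\in X: F(x)\subseteq \mathrm{CH}(\bigcup_{y\in Y}F(y))\}$. -}

module Defs where

import Algebra.Bundles as Algebra
import Algebra.Properties.CommutativeSemigroup as CommutativeSemigroupProperties
open import Data.Fin.Base using (Fin)
open import Data.Fin.Subset
  using (Subset; ⊥; ⊤; ⁅_⁆; _∈_; _∉_; _⊆_; _∩_; _∪_)
open import Data.Nat.Base as ℕ using (ℕ)
import Data.Nat.Properties as ℕP
open import Data.Product.Base using (Σ; Σ-syntax; ∃-syntax; _×_; _,_)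
open import Data.Rational.Base as ℚ using (ℚ; 0ℚ; 1ℚ; ½; 1/_; ∣_∣)
import Data.Rational.Properties as ℚP
open import Data.Sum.Base using (_⊎_)
open import Data.Vec.Functional using (Vector; foldr)
open import Function.Bundles using (_⇔_)
open import Function.Definitions using (Injective)
open import Level using (0ℓ)
open import Relation.Binary.PropositionalEquality
  using (_≡_; _≢_; sym; trans; cong; cong₂; subst;
         module ≡-Reasoning)
import Relation.Unary as U
open U using (Pred; _≐_)

-- The finite ground set X is Fin n, and 2^X is Subset n.

record IsClosureOperator {n : ℕ} (φ : Subset n → Subset n) : Set where
  field
    extensive  : ∀ Y → Y ⊆ φ Y
    monotone   : ∀ Y Z → Y ⊆ Z → φ Y ⊆ φ Z
    idempotent : ∀ Y → φ (φ Y) ≡ φ Y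

Closed : ∀ {n} → (Subset n → Subset n) → Pred (Subset n) 0ℓ
Closed φ Y = φ Y ≡ Y

record ConvexGeometry (n : ℕ) : Set where
  field
    φ                 : Subset n → Subset n
    isClosureOperator : IsClosureOperator φ
    φ-empty           : φ ⊥ ≡ ⊥
    antiExchange      : ∀ Y → Closed φ Y → ∀ x y → x ∉ Y → y ∉ Y → x ≢ y →
                        x ∈ φ (Y ∪ ⁅ y ⁆) → y ∉ φ (Y ∪ ⁅ x ⁆)

open ConvexGeometry public using (φ)

closedSets : ∀ {n} → ConvexGeometry n → Pred (Subset n) 0ℓ
closedSets G = Closed (φ G)

Monotone : ∀ {n} → ConvexGeometry n → Set
Monotone G = ∀ A B → closedSets G A → closedSets G B → A ⊆ B ⊎ B ⊆ A

record IsClosureSpace {n : ℕ} (F : Pred (Subset n) 0ℓ) : Set where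
  field
    containsX : F ⊤
    ∩-closed  : ∀ A B → F A → F B → F (A ∩ B)

record IsJoin {n k : ℕ} (F : Fin k → Pred (Subset n) 0ℓ)
              (J : Pred (Subset n) 0ℓ) : Set₁ where
  field
    isClosureSpace : IsClosureSpace J
    contains       : ∀ i → F i U.⊆ J
    least          : ∀ L → IsClosureSpace L → (∀ i → F i U.⊆ L) → J U.⊆ L

IsJoinOfMonotone : ∀ {n} → ConvexGeometry n → ℕ → Set₁
IsJoinOfMonotone {n} G k =
  Σ[ M ∈ (Fin k → ConvexGeometry n) ]
    (∀ i → Monotone (M i)) × IsJoin (λ i → closedSets (M i)) (closedSets G)

HasConvexDimension : ∀ {n} → ConvexGeometry n → ℕ → Set₁
HasConvexDimension G k =
  IsJoinOfMonotone G k × (∀ j → IsJoinOfMonotone G j → k ℕ.≤ j)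

-- The real numbers are Cauchy sequences of rationals with pointwise
-- operations, up to the equivalence _≈ℝ_ (null difference).

IsCauchy : (ℕ → ℚ) → Set
IsCauchy s = ∀ ε → 0ℚ ℚ.< ε →
  ∃[ N ] (∀ m n → N ℕ.≤ m → N ℕ.≤ n → ∣ s m ℚ.- s n ∣ ℚ.< ε)

record ℝ : Set where
  constructor mkℝ
  field
    seq    : ℕ → ℚ
    cauchy : IsCauchy seq

open ℝ public

infix  4 _≈ℝ_ _≤ℝ_
infixl 6 _+ℝ_ _-ℝ_
infixl 7 _*ℝ_
infix  8 -ℝ_

_≈ℝ_ : ℝ → ℝ → Set
x ≈ℝ y = ∀ ε → 0ℚ ℚ.< ε →
  ∃[ N ] (∀ n → N ℕ.≤ n → ∣ seq x n ℚ.- seq y n ∣ ℚ.< ε)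

-- A bound up to every ε: a pointwise seq x n ≤ seq y n would not respect _≈ℝ_.
_≤ℝ_ : ℝ → ℝ → Set
x ≤ℝ y = ∀ ε → 0ℚ ℚ.< ε →
  ∃[ N ] (∀ n → N ℕ.≤ n → seq x n ℚ.< seq y n ℚ.+ ε)

private

  open CommutativeSemigroupProperties
    (Algebra.CommutativeMonoid.commutativeSemigroup ℚP.+-0-commutativeMonoid)
    using (interchange)

  p≡p-q+q : ∀ p q → p ≡ (p ℚ.- q) ℚ.+ q
  p≡p-q+q p q = sym (trans (ℚP.+-assoc p (ℚ.- q) q)
               (trans (cong (p ℚ.+_) (ℚP.+-inverseˡ q)) (ℚP.+-identityʳ p)))

  sum-difference : ∀ a b c d →
    (a ℚ.+ b) ℚ.- (c ℚ.+ d) ≡ (a ℚ.- c) ℚ.+ (b ℚ.- d)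
  sum-difference a b c d =
    trans (cong (a ℚ.+ b ℚ.+_) (ℚP.neg-distrib-+ c d))
          (interchange a b (ℚ.- c) (ℚ.- d))

  product-difference : ∀ a b c d →
    a ℚ.* b ℚ.- c ℚ.* d ≡ a ℚ.* (b ℚ.- d) ℚ.+ d ℚ.* (a ℚ.- c)
  product-difference a b c d = begin
    a ℚ.* b ℚ.- c ℚ.* d
      ≡⟨ cong (ℚ._- c ℚ.* d) (p≡p-q+q (a ℚ.* b) (a ℚ.* d)) ⟩
    (a ℚ.* b ℚ.- a ℚ.* d ℚ.+ a ℚ.* d) ℚ.- c ℚ.* d
      ≡⟨ ℚP.+-assoc (a ℚ.* b ℚ.- a ℚ.* d) (a ℚ.* d) (ℚ.- (c ℚ.* d)) ⟩
    (a ℚ.* b ℚ.- a ℚ.* d) ℚ.+ (a ℚ.* d ℚ.- c ℚ.* d)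
      ≡⟨ cong₂ ℚ._+_ (*-distribˡ-- a b d)
           (trans (cong₂ ℚ._-_ (ℚP.*-comm a d) (ℚP.*-comm c d)) (*-distribˡ-- d a c)) ⟩
    a ℚ.* (b ℚ.- d) ℚ.+ d ℚ.* (a ℚ.- c) ∎
    where
    open ≡-Reasoning
    *-distribˡ-- : ∀ p q r → p ℚ.* q ℚ.- p ℚ.* r ≡ p ℚ.* (q ℚ.- r)
    *-distribˡ-- p q r =
      trans (cong (p ℚ.* q ℚ.+_) (ℚP.neg-distribʳ-* p r))
            (sym (ℚP.*-distribˡ-+ p q (ℚ.- r)))

half-pos : ∀ ε → 0ℚ ℚ.< ε → 0ℚ ℚ.< ½ ℚ.* ε
half-pos ε 0<ε =
  subst (ℚ._< ½ ℚ.* ε) (ℚP.*-zeroʳ ½) (ℚP.*-monoʳ-<-pos ½ 0<ε)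

half+half : ∀ ε → ½ ℚ.* ε ℚ.+ ½ ℚ.* ε ≡ ε
half+half ε =
  trans (sym (ℚP.*-distribʳ-+ ε ½ ½)) (ℚP.*-identityˡ ε)

EventualBound : (ℕ → ℚ) → ℚ → ℕ → Set
EventualBound s B N = 0ℚ ℚ.< B × (∀ n → N ℕ.≤ n → ∣ s n ∣ ℚ.< B)

bounded : ∀ s → IsCauchy s → ∃[ B ] ∃[ N ] EventualBound s B N
bounded s c with c 1ℚ (ℚP.positive⁻¹ 1ℚ)
... | N , close = 1ℚ ℚ.+ ∣ s N ∣ , N , B-pos , below
  where
  B-pos : 0ℚ ℚ.< 1ℚ ℚ.+ ∣ s N ∣
  B-pos = ℚP.+-mono-<-≤ (ℚP.positive⁻¹ 1ℚ) (ℚP.0≤∣p∣ (s N))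
  below : ∀ n → N ℕ.≤ n → ∣ s n ∣ ℚ.< 1ℚ ℚ.+ ∣ s N ∣
  below n N≤n = begin-strict
    ∣ s n ∣
      ≡⟨ cong ∣_∣ (p≡p-q+q (s n) (s N)) ⟩
    ∣ (s n ℚ.- s N) ℚ.+ s N ∣
      ≤⟨ ℚP.∣p+q∣≤∣p∣+∣q∣ (s n ℚ.- s N) (s N) ⟩
    ∣ s n ℚ.- s N ∣ ℚ.+ ∣ s N ∣
      <⟨ ℚP.+-monoˡ-< ∣ s N ∣ (close n N N≤n ℕP.≤-refl) ⟩
    1ℚ ℚ.+ ∣ s N ∣ ∎
    where open ℚP.≤-Reasoning

divide : ∀ B ε → 0ℚ ℚ.< B → 0ℚ ℚ.< ε → ∃[ δ ] (0ℚ ℚ.< δ × B ℚ.* δ ≡ ε)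
divide B ε 0<B 0<ε = 1/ B ℚ.* ε , δ-pos , B*δ
  where
  instance
    posB = ℚ.positive 0<B
    nzB  = ℚP.pos⇒nonZero B
    posI = ℚP.1/pos⇒pos B
  δ-pos : 0ℚ ℚ.< 1/ B ℚ.* ε
  δ-pos = subst (ℚ._< 1/ B ℚ.* ε) (ℚP.*-zeroʳ (1/ B))
                (ℚP.*-monoʳ-<-pos (1/ B) 0<ε)
  B*δ : B ℚ.* (1/ B ℚ.* ε) ≡ ε
  B*δ = trans (sym (ℚP.*-assoc B (1/ B) ε))
       (trans (cong (ℚ._* ε) (ℚP.*-inverseʳ B)) (ℚP.*-identityˡ ε))

∣p*q∣<B*δ : ∀ p q B δ → 0ℚ ℚ.< B → ∣ p ∣ ℚ.< B → ∣ q ∣ ℚ.< δ →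
            ∣ p ℚ.* q ∣ ℚ.< B ℚ.* δ
∣p*q∣<B*δ p q B δ 0<B p<B q<δ = begin-strict
  ∣ p ℚ.* q ∣      ≡⟨ ℚP.∣p*q∣≡∣p∣*∣q∣ p q ⟩
  ∣ p ∣ ℚ.* ∣ q ∣  ≤⟨ ℚP.*-monoʳ-≤-nonNeg ∣ q ∣ {{ℚ.nonNegative (ℚP.0≤∣p∣ q)}}
                                          (ℚP.<⇒≤ p<B) ⟩
  B ℚ.* ∣ q ∣      <⟨ ℚP.*-monoʳ-<-pos B {{ℚ.positive 0<B}} q<δ ⟩
  B ℚ.* δ          ∎
  where open ℚP.≤-Reasoning

const-cauchy : ∀ q → IsCauchy (λ _ → q)
const-cauchy q ε 0<ε = 0 , λ _ _ _ _ →
  subst (λ z → ∣ z ∣ ℚ.< ε) (sym (ℚP.+-inverseʳ q)) 0<ε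

+-cauchy : ∀ s t → IsCauchy s → IsCauchy t → IsCauchy (λ n → s n ℚ.+ t n)
+-cauchy s t cs ct ε 0<ε
  with cs (½ ℚ.* ε) (half-pos ε 0<ε) | ct (½ ℚ.* ε) (half-pos ε 0<ε)
... | M , closeS | N , closeT = M ℕ.⊔ N , λ m n M⊔N≤m M⊔N≤n → begin-strict
    ∣ (s m ℚ.+ t m) ℚ.- (s n ℚ.+ t n) ∣
      ≡⟨ cong ∣_∣ (sum-difference (s m) (t m) (s n) (t n)) ⟩
    ∣ (s m ℚ.- s n) ℚ.+ (t m ℚ.- t n) ∣
      ≤⟨ ℚP.∣p+q∣≤∣p∣+∣q∣ (s m ℚ.- s n) (t m ℚ.- t n) ⟩
    ∣ s m ℚ.- s n ∣ ℚ.+ ∣ t m ℚ.- t n ∣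
      <⟨ ℚP.+-mono-<
           (closeS m n (ℕP.m⊔n≤o⇒m≤o M N M⊔N≤m) (ℕP.m⊔n≤o⇒m≤o M N M⊔N≤n))
           (closeT m n (ℕP.m⊔n≤o⇒n≤o M N M⊔N≤m) (ℕP.m⊔n≤o⇒n≤o M N M⊔N≤n)) ⟩
    ½ ℚ.* ε ℚ.+ ½ ℚ.* ε
      ≡⟨ half+half ε ⟩
    ε ∎
  where open ℚP.≤-Reasoning

neg-cauchy : ∀ s → IsCauchy s → IsCauchy (λ n → ℚ.- s n)
neg-cauchy s cs ε 0<ε with cs ε 0<ε
... | N , close = N , λ m n N≤m N≤n →
  subst (ℚ._< ε)
        (trans (sym (ℚP.∣-p∣≡∣p∣ (s m ℚ.- s n)))
               (cong ∣_∣ (ℚP.neg-distrib-+ (s m) (ℚ.- s n))))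
        (close m n N≤m N≤n)

*-cauchy : ∀ s t → IsCauchy s → IsCauchy t → IsCauchy (λ n → s n ℚ.* t n)
*-cauchy s t cs ct ε 0<ε
  with bounded s cs | bounded t ct
... | A , N₁ , 0<A , s<A | B , N₂ , 0<B , t<B
  with divide A (½ ℚ.* ε) 0<A (half-pos ε 0<ε)
     | divide B (½ ℚ.* ε) 0<B (half-pos ε 0<ε)
... | δ , 0<δ , Aδ | η , 0<η , Bη
  with ct δ 0<δ | cs η 0<η
... | N₃ , closeT | N₄ , closeS = N , close
  where
  open ℚP.≤-Reasoning
  N = (N₁ ℕ.⊔ N₂) ℕ.⊔ (N₃ ℕ.⊔ N₄)
  module _ {m} (N≤m : N ℕ.≤ m) where
    N₁₂≤ = ℕP.m⊔n≤o⇒m≤o (N₁ ℕ.⊔ N₂) (N₃ ℕ.⊔ N₄) N≤m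
    N₃₄≤ = ℕP.m⊔n≤o⇒n≤o (N₁ ℕ.⊔ N₂) (N₃ ℕ.⊔ N₄) N≤m
    N₁≤ = ℕP.m⊔n≤o⇒m≤o N₁ N₂ N₁₂≤
    N₂≤ = ℕP.m⊔n≤o⇒n≤o N₁ N₂ N₁₂≤
    N₃≤ = ℕP.m⊔n≤o⇒m≤o N₃ N₄ N₃₄≤
    N₄≤ = ℕP.m⊔n≤o⇒n≤o N₃ N₄ N₃₄≤
  close : ∀ m n → N ℕ.≤ m → N ℕ.≤ n →
          ∣ s m ℚ.* t m ℚ.- s n ℚ.* t n ∣ ℚ.< ε
  close m n N≤m N≤n = begin-strict
    ∣ s m ℚ.* t m ℚ.- s n ℚ.* t n ∣
      ≡⟨ cong ∣_∣ (product-difference (s m) (t m) (s n) (t n)) ⟩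
    ∣ s m ℚ.* (t m ℚ.- t n) ℚ.+ t n ℚ.* (s m ℚ.- s n) ∣
      ≤⟨ ℚP.∣p+q∣≤∣p∣+∣q∣ (s m ℚ.* (t m ℚ.- t n)) (t n ℚ.* (s m ℚ.- s n)) ⟩
    ∣ s m ℚ.* (t m ℚ.- t n) ∣ ℚ.+ ∣ t n ℚ.* (s m ℚ.- s n) ∣
      <⟨ ℚP.+-mono-<
           (∣p*q∣<B*δ (s m) (t m ℚ.- t n) A δ 0<A (s<A m (N₁≤ N≤m))
                      (closeT m n (N₃≤ N≤m) (N₃≤ N≤n)))
           (∣p*q∣<B*δ (t n) (s m ℚ.- s n) B η 0<B (t<B n (N₂≤ N≤n))
                      (closeS m n (N₄≤ N≤m) (N₄≤ N≤n))) ⟩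
    A ℚ.* δ ℚ.+ B ℚ.* η
      ≡⟨ cong₂ ℚ._+_ Aδ Bη ⟩
    ½ ℚ.* ε ℚ.+ ½ ℚ.* ε
      ≡⟨ half+half ε ⟩
    ε ∎

fromℚ : ℚ → ℝ
fromℚ q = mkℝ (λ _ → q) (const-cauchy q)

0ℝ 1ℝ : ℝ
0ℝ = fromℚ 0ℚ
1ℝ = fromℚ 1ℚ

_+ℝ_ _*ℝ_ : ℝ → ℝ → ℝ
mkℝ s cs +ℝ mkℝ t ct = mkℝ (λ n → s n ℚ.+ t n) (+-cauchy s t cs ct)
mkℝ s cs *ℝ mkℝ t ct = mkℝ (λ n → s n ℚ.* t n) (*-cauchy s t cs ct)

-ℝ_ : ℝ → ℝ
-ℝ mkℝ s cs = mkℝ (λ n → ℚ.- s n) (neg-cauchy s cs)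

_-ℝ_ : ℝ → ℝ → ℝ
x -ℝ y = x +ℝ (-ℝ y)

sumℝ : ∀ {n} → Vector ℝ n → ℝ
sumℝ = foldr _+ℝ_ 0ℝ

Point : ℕ → Set
Point t = Vector ℝ t

sqDist : ∀ {t} → Point t → Point t → ℝ
sqDist p q = sumℝ (λ j → (p j -ℝ q j) *ℝ (p j -ℝ q j))

record Sphere (t : ℕ) : Set where
  field
    centre   : Point t
    radius   : ℝ
    radius≥0 : 0ℝ ≤ℝ radius

-- The solid ball.  As radius ≥ 0, comparing squares is comparing distances.
points : ∀ {t} → Sphere t → Pred (Point t) 0ℓ
points S p = sqDist p centre ≤ℝ radius *ℝ radius
  where open Sphere S

CH : ∀ {t} → Pred (Point t) 0ℓ → Pred (Point t) 0ℓ
CH {t} S p =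
  ∃[ m ] Σ[ q ∈ (Fin m → Point t) ] Σ[ w ∈ Vector ℝ m ]
    (∀ i → S (q i)) ×
    (∀ i → 0ℝ ≤ℝ w i) ×
    sumℝ w ≈ℝ 1ℝ ×
    (∀ j → p j ≈ℝ sumℝ (λ i → w i *ℝ q i j))

-- Spheres are compared as point sets, so the choice of Cauchy sequences for
-- centre and radius does not matter.
RepresentableBySpheres : ∀ {n} → ConvexGeometry n → ℕ → Set
RepresentableBySpheres {n} G t =
  Σ[ F ∈ (Fin n → Sphere t) ]
    Injective _≡_ (λ S T → points S ≐ points T) F ×
    (∀ Y x → x ∈ φ G Y ⇔
             points (F x) U.⊆ CH (λ p → ∃[ y ] (y ∈ Y × points (F y) p)))

{-# OPTIONS --safe #-}

-- On a unit vector u the support function of a ball with centre c and radius r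
-- is c · u + r.  Hence the difference g of the support functions of two nested
-- balls is affine and nonnegative on the unit sphere, so for unit vectors
-- A, B, C the numbers |B-C| √g(A), |C-A| √g(B), |A-B| √g(C) satisfy the triangle
-- inequality; in particular
--   |B-C|² g(A) ≤ 2 (|C-A|² g(B) + |A-B|² g(C)).
-- The geometry is given by three linear orders.  In each order σ one point, the
-- pivot, lies low, but it lies high in the other two orders.  In a direction u_σ
-- in which another point just above the pivot in σ sticks out of the pivot, the
-- support values of the points above the pivot are then sorted as in σ.  For
-- each σ there are five nested pairs of balls which span the whole range at u_σ,
-- while at each of the other two directions they follow one another within the
-- range.  If I_σ is the range at u_σ, weighted by the squared distance of the
-- other two directions, then adding the inequalities of the five pairs gives
-- 5 I_σ ≤ 2 (I_ρ + I_τ), and adding up over σ gives 5 Σ I ≤ 4 Σ I, although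
-- Σ I > 0.

module Submission where

open import Data.Nat.Base using (ℕ; _≤_)
open import Data.Product.Base using (Σ-syntax; ∃-syntax; _×_)
open import Relation.Nullary.Negation.Core using (¬_)
open import Defs

open import Algebra.Bundles using (CommutativeRing)
import Algebra.Properties.CommutativeMonoid.Sum as MonoidSum
import Algebra.Properties.Semiring.Sum as SemiringSum
import Algebra.Solver.Ring as RingSolver
import Algebra.Solver.Ring.AlmostCommutativeRing as ACR
open import Algebra.Structures using (IsCommutativeRing)
import Data.Empty as Empty
open import Data.Fin using (#_)
open import Data.Fin.Base using (Fin; zero; suc; inject₁; fromℕ; combine; remQuot)
import Data.Fin.Properties as FinP
open import Data.Fin.Subset
  using (Subset; ⊥; ⊤; ⁅_⁆; _∈_; _∉_; _⊆_; _∩_; _∪_; ∁)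
open import Data.Fin.Subset.Properties
  using (_∈?_; ∉⊥; ∈⊤; ⊆⊤; x∈⁅x⁆; x∈⁅y⁆⇒x≡y; ⊆-antisym; ⊆-refl; Empty-unique;
         p∩q⊆p; p∩q⊆q; x∈p∩q⁺; x∈p∪q⁻; x∈p∪q⁺; x∈p⇒x∉∁p; x∉p⇒x∈∁p; x∈∁p⇒x∉p)
open import Data.Maybe.Base using (just; nothing)
open import Data.Nat.Base as ℕ using (_<_)
import Data.Nat.Properties as ℕP
open import Data.Product.Base using (_,_; proj₁; proj₂)
open import Data.Rational.Base as ℚ using (ℚ; 0ℚ; 1ℚ; ½; ∣_∣)
import Data.Rational.Properties as ℚP
open import Data.Rational.Solver using (module +-*-Solver)
open import Data.Sum.Base using (_⊎_; inj₁; inj₂; [_,_]′)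
open import Data.Unit.Base using (tt)
open import Data.Vec.Base using (Vec; []; _∷_; lookup; tabulate)
open import Data.Vec.Functional using (Vector; foldr)
open import Data.Vec.Properties using (lookup∘tabulate; lookup⇒[]=; []=⇒lookup)
open import Function.Base using (_∘_; const)
open import Function.Bundles using (module Equivalence)
open import Function.Definitions using (Injective)
open import Level using (0ℓ)
open import Relation.Binary.Definitions using (WeaklyDecidable)
open import Relation.Binary.PropositionalEquality as ≡ using (_≡_; _≢_)
import Relation.Binary.Reasoning.Setoid as SetoidReasoning
open import Relation.Nullary
  using (Dec; yes; no; does; ¬?; _×-dec_; _→-dec_; contradiction)
open import Relation.Nullary.Decidable using (dec-true; toWitness)
open import Relation.Unary using (Pred; Decidable)

-- Convex geometries given by linear orders

module _ {n} {P : Pred (Fin n) 0ℓ} (P? : Decidable P) where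

  comprehension : Subset n
  comprehension = tabulate (does ∘ P?)

  ∈-comprehension⁺ : ∀ {x} → P x → x ∈ comprehension
  ∈-comprehension⁺ {x} Px =
    lookup⇒[]= x _ (≡.trans (lookup∘tabulate _ x) (dec-true (P? x) Px))

  ∈-comprehension⁻ : ∀ {x} → x ∈ comprehension → P x
  ∈-comprehension⁻ {x} x∈
    with P? x | ≡.trans (≡.sym ([]=⇒lookup x∈)) (lookup∘tabulate (does ∘ P?) x)
  ... | yes Px | _ = Px

module OrderGeometry {n k : ℕ} (rank : Fin (ℕ.suc k) → Fin n → ℕ)
                     (rank-injective : ∀ σ → Injective _≡_ _≡_ (rank σ)) where

  -- Closure in the join of the chains: the smallest initial segments containing `Y`, one per order,
  -- are intersected. The index type `Fin (suc k)` supplies at least one order, so that the hull of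
  -- the empty set is empty.
  Dominated : Subset n → Fin n → Set
  Dominated Y x = ∀ σ → ∃[ y ] (y ∈ Y × rank σ x ≤ rank σ y)

  dominated? : ∀ Y x → Dec (Dominated Y x)
  dominated? Y x = FinP.all? λ σ → FinP.any? λ y →
    (y ∈? Y) ×-dec (rank σ x ℕP.≤? rank σ y)

  hull : Subset n → Subset n
  hull Y = comprehension (dominated? Y)

  ∈-hull⁺ : ∀ {Y x} → Dominated Y x → x ∈ hull Y
  ∈-hull⁺ {Y} = ∈-comprehension⁺ (dominated? Y)

  ∈-hull⁻ : ∀ {Y x} → x ∈ hull Y → Dominated Y x
  ∈-hull⁻ {Y} = ∈-comprehension⁻ (dominated? Y)

  ∉-hull⁻ : ∀ {Y x} → x ∉ hull Y → ∃[ σ ] (∀ y → y ∈ Y → rank σ y < rank σ x)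
  ∉-hull⁻ {Y} {x} x∉ with FinP.¬∀⟶∃¬ _ _
      (λ σ → FinP.any? λ y → (y ∈? Y) ×-dec (rank σ x ℕP.≤? rank σ y)) (x∉ ∘ ∈-hull⁺)
  ... | σ , none = σ , λ y y∈Y → ℕP.≰⇒> λ x≤y → none (y , y∈Y , x≤y)

  hull-extensive : ∀ Y → Y ⊆ hull Y
  hull-extensive Y {x} x∈Y = ∈-hull⁺ λ σ → x , x∈Y , ℕP.≤-refl

  hull-isClosureOperator : IsClosureOperator hull
  hull-isClosureOperator = record
    { extensive  = hull-extensive
    ; monotone   = λ Y Z Y⊆Z x∈ → ∈-hull⁺ λ σ →
        let y , y∈Y , x≤y = ∈-hull⁻ x∈ σ in y , Y⊆Z y∈Y , x≤y
    ; idempotent = λ Y → ⊆-antisym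
        (λ x∈ → ∈-hull⁺ λ σ →
          let y , y∈ , x≤y = ∈-hull⁻ x∈ σ
              z , z∈Y , y≤z = ∈-hull⁻ y∈ σ
          in z , z∈Y , ℕP.≤-trans x≤y y≤z)
        (hull-extensive (hull Y))
    }

  hull-empty : hull ⊥ ≡ ⊥
  hull-empty = Empty-unique λ (x , x∈) → ∉⊥ (proj₁ (proj₂ (∈-hull⁻ x∈ zero)))

  -- As `x` is outside the closed set `Y`, some order puts it strictly above all of `Y`. There only
  -- `y` can witness `x ∈ hull (Y ∪ ⁅ y ⁆)`, while every witness for `y` is at most `x`; hence `x`
  -- and `y` share a rank.
  hull-antiExchange : ∀ Y → hull Y ≡ Y → ∀ x y → x ∉ Y → y ∉ Y → x ≢ y →
                      x ∈ hull (Y ∪ ⁅ y ⁆) → y ∉ hull (Y ∪ ⁅ x ⁆)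
  hull-antiExchange Y closed x y x∉Y y∉Y x≢y x∈ y∈
    with ∉-hull⁻ (x∉Y ∘ ≡.subst (x ∈_) closed)
  ... | σ , Y<x = x≢y (rank-injective σ (ℕP.≤-antisym x≤y y≤x))
    where
    x≤y : rank σ x ≤ rank σ y
    x≤y with ∈-hull⁻ x∈ σ
    ... | z , z∈ , x≤z with x∈p∪q⁻ Y ⁅ y ⁆ z∈
    ...   | inj₁ z∈Y = Empty.⊥-elim (ℕP.<⇒≱ (Y<x z z∈Y) x≤z)
    ...   | inj₂ z∈y = ≡.subst (λ z → rank σ x ≤ rank σ z) (x∈⁅y⁆⇒x≡y y z∈y) x≤z
    y≤x : rank σ y ≤ rank σ x
    y≤x with ∈-hull⁻ y∈ σ
    ... | z , z∈ , y≤z with x∈p∪q⁻ Y ⁅ x ⁆ z∈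
    ...   | inj₁ z∈Y = ℕP.<⇒≤ (ℕP.≤-<-trans y≤z (Y<x z z∈Y))
    ...   | inj₂ z∈x = ≡.subst (λ z → rank σ y ≤ rank σ z) (x∈⁅y⁆⇒x≡y x z∈x) y≤z

  geometry : ConvexGeometry n
  geometry = record
    { φ = hull ; isClosureOperator = hull-isClosureOperator
    ; φ-empty = hull-empty ; antiExchange = hull-antiExchange }

  ∈-hull-pair : ∀ {x y z} → (∀ σ → rank σ x ≤ rank σ y ⊎ rank σ x ≤ rank σ z) →
                x ∈ hull (⁅ y ⁆ ∪ ⁅ z ⁆)
  ∈-hull-pair {x} {y} {z} below = ∈-hull⁺ λ σ →
    [ (λ x≤y → y , x∈p∪q⁺ (inj₁ (x∈⁅x⁆ y)) , x≤y)
    , (λ x≤z → z , x∈p∪q⁺ (inj₂ (x∈⁅x⁆ z)) , x≤z) ]′ (below σ)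

  ∉-hull-singleton : ∀ {x y} σ → rank σ y < rank σ x → x ∉ hull ⁅ y ⁆
  ∉-hull-singleton {x} {y} σ y<x x∈ with ∈-hull⁻ x∈ σ
  ... | z , z∈ , x≤z rewrite x∈⁅y⁆⇒x≡y y z∈ = ℕP.<⇒≱ y<x x≤z

-- Closed sets are initial segments. If `x` is in `A` but not in `B`, no member of `B` can exceed
-- `x`, so all of `B` lies at or below a member of `A`.
single-order-monotone : ∀ {n} (rank : Fin 1 → Fin n → ℕ) inj →
                        Monotone (OrderGeometry.geometry rank inj)
single-order-monotone {n} rank inj A B closedA closedB
  with FinP.any? (λ x → (x ∈? A) ×-dec (¬? (x ∈? B)))
... | no none = inj₁ λ {x} x∈A → case x x∈A
  where
  case : ∀ x → x ∈ A → x ∈ B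
  case x x∈A with x ∈? B
  ... | yes x∈B = x∈B
  ... | no  x∉B = Empty.⊥-elim (none (x , x∈A , x∉B))
... | yes (x , x∈A , x∉B) = inj₂ λ {y} y∈B → ≡.subst (y ∈_) closedA
  (∈-hull⁺ λ { zero → x , x∈A , ℕP.≮⇒≥ λ x<y →
    x∉B (≡.subst (x ∈_) closedB (∈-hull⁺ λ { zero → y , y∈B , ℕP.<⇒≤ x<y })) })
  where open OrderGeometry rank inj

-- Joins of chains, and a lower bound for the number of chains

module Join {n k : ℕ} (rank : Fin (ℕ.suc k) → Fin n → ℕ)
            (rank-injective : ∀ σ → Injective _≡_ _≡_ (rank σ)) where

  open OrderGeometry rank rank-injective
  module Chain σ = OrderGeometry {k = 0} (const (rank σ)) (const (rank-injective σ))

  closure-space : ∀ {m} (G : ConvexGeometry m) → IsClosureSpace (closedSets G)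
  closure-space G = record
    { containsX = ⊆-antisym ⊆⊤ (extensive ⊤)
    ; ∩-closed  = λ A B closedA closedB → ⊆-antisym
        (λ x∈ → x∈p∩q⁺
          ( ≡.subst (_ ∈_) closedA (monotone (A ∩ B) A (p∩q⊆p A B) x∈)
          , ≡.subst (_ ∈_) closedB (monotone (A ∩ B) B (p∩q⊆q A B) x∈)))
        (extensive (A ∩ B))
    }
    where
    open ConvexGeometry G using (isClosureOperator)
    open IsClosureOperator isClosureOperator

  ⋂ : ∀ {m} → Vector (Subset n) m → Subset n
  ⋂ = foldr _∩_ ⊤

  ∈-⋂⁺ : ∀ {m x} (V : Vector (Subset n) m) → (∀ i → x ∈ V i) → x ∈ ⋂ V
  ∈-⋂⁺ {ℕ.zero}  V x∈ = ∈⊤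
  ∈-⋂⁺ {ℕ.suc m} V x∈ = x∈p∩q⁺ (x∈ zero , ∈-⋂⁺ (V ∘ suc) (x∈ ∘ suc))

  ∈-⋂⁻ : ∀ {m x} (V : Vector (Subset n) m) → x ∈ ⋂ V → ∀ i → x ∈ V i
  ∈-⋂⁻ V x∈ zero    = p∩q⊆p (V zero) _ x∈
  ∈-⋂⁻ V x∈ (suc i) = ∈-⋂⁻ (V ∘ suc) (p∩q⊆q (V zero) _ x∈) i

  ⋂-closed : ∀ {m L} → IsClosureSpace L → (V : Vector (Subset n) m) →
             (∀ i → L (V i)) → L (⋂ V)
  ⋂-closed {ℕ.zero}  cs V LV = IsClosureSpace.containsX cs
  ⋂-closed {ℕ.suc m} cs V LV =
    IsClosureSpace.∩-closed cs _ _ (LV zero) (⋂-closed cs (V ∘ suc) (LV ∘ suc))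

  hull≡⋂ : ∀ Y → hull Y ≡ ⋂ (λ σ → Chain.hull σ Y)
  hull≡⋂ Y = ⊆-antisym
    (λ x∈ → ∈-⋂⁺ _ λ σ → Chain.∈-hull⁺ σ λ _ → ∈-hull⁻ x∈ σ)
    (λ x∈ → ∈-hull⁺ λ σ → Chain.∈-hull⁻ σ (∈-⋂⁻ (λ σ → Chain.hull σ Y) x∈ σ) zero)

  -- Sets closed in one chain are closed because domination in all orders implies domination in that
  -- one. For leastness, `hull≡⋂` writes a closed set as a finite intersection of sets closed in the
  -- chains.
  isJoinOfMonotone : IsJoinOfMonotone geometry (ℕ.suc k)
  isJoinOfMonotone =
    Chain.geometry ,
    (λ σ → single-order-monotone (const (rank σ)) (const (rank-injective σ))) , record
      { isClosureSpace = closure-space geometry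
      ; contains = λ σ {Y} closed → ⊆-antisym
          (λ {x} x∈ → ≡.subst (x ∈_) closed (Chain.∈-hull⁺ σ λ _ → ∈-hull⁻ x∈ σ))
          (hull-extensive Y)
      ; least = λ L cs chains⊆L {Y} closed → ≡.subst L (≡.trans (≡.sym (hull≡⋂ Y)) closed)
          (⋂-closed {L = L} cs _ λ σ → chains⊆L σ
            (IsClosureOperator.idempotent (Chain.hull-isClosureOperator σ) Y))
      }

-- The complement of an extreme point is a coatom of the lattice of closed
-- sets, so it must already be a member of one of the chains.
extreme-points≤join-size : ∀ {n m j} (G : ConvexGeometry n) (a : Fin m → Fin n) →
  Injective _≡_ _≡_ a → (∀ i → closedSets G (∁ ⁅ a i ⁆)) →
  IsJoinOfMonotone G j → m ≤ j
extreme-points≤join-size {n} {m} {j} G a a-injective closed (M , mono , join) =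
  FinP.injective⇒≤ chain-injective
  where
  -- Each missing point must be avoided by a superset closed in a single chain. Such sets form a
  -- closure space containing the chains, so leastness of the join makes every closed set of `G`
  -- avoidable.
  Avoidable : Subset n → Set
  Avoidable Y = ∀ b → b ∉ Y → ∃[ i ] ∃[ Z ] (closedSets (M i) Z × b ∉ Z × Y ⊆ Z)

  avoidable-space : IsClosureSpace Avoidable
  avoidable-space = record
    { containsX = λ b b∉⊤ → Empty.⊥-elim (b∉⊤ ∈⊤)
    ; ∩-closed  = ∩-closed
    }
    where
    ∩-closed : ∀ A B → Avoidable A → Avoidable B → Avoidable (A ∩ B)
    ∩-closed A B avA avB b b∉ with b ∈? A
    ... | no b∉A = let i , Z , cZ , b∉Z , A⊆Z = avA b b∉A
                   in i , Z , cZ , b∉Z , λ x∈ → A⊆Z (p∩q⊆p A B x∈)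
    ... | yes b∈A = let i , Z , cZ , b∉Z , B⊆Z = avB b (λ b∈B → b∉ (x∈p∩q⁺ (b∈A , b∈B)))
                    in i , Z , cZ , b∉Z , λ x∈ → B⊆Z (p∩q⊆q A B x∈)

  avoid : ∀ i → ∃[ l ] ∃[ Z ] (closedSets (M l) Z × a i ∉ Z × ∁ ⁅ a i ⁆ ⊆ Z)
  avoid i = IsJoin.least join Avoidable avoidable-space
    (λ l {Y} cY b b∉Y → l , Y , cY , b∉Y , ⊆-refl)
    (closed i) (a i) (x∈p⇒x∉∁p (x∈⁅x⁆ (a i)))

  chain : Fin m → Fin j
  chain i = proj₁ (avoid i)

  chain-injective : Injective _≡_ _≡_ chain
  chain-injective {i} {i′} same with a i FinP.≟ a i′
  ... | yes eq = a-injective eq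
  ... | no  ai≢ai′ with avoid i | avoid i′ | same
  ... | l , Z , cZ , ai∉Z , ⊆Z | _ , Z′ , cZ′ , ai′∉Z′ , ⊆Z′ | ≡.refl with mono l Z Z′ cZ cZ′
  -- `Z` and `Z′` each omit only their own extreme point, so an inclusion either way would put the
  -- point omitted by the larger set into it.
  ...   | inj₁ Z⊆Z′ = Empty.⊥-elim (ai′∉Z′ (Z⊆Z′ (⊆Z (x∉p⇒x∈∁p (ai≢ai′ ∘ ≡.sym ∘ x∈⁅y⁆⇒x≡y _)))))
  ...   | inj₂ Z′⊆Z = Empty.⊥-elim (ai∉Z (Z′⊆Z (⊆Z′ (x∉p⇒x∈∁p (ai≢ai′ ∘ x∈⁅y⁆⇒x≡y _)))))

-- Support functions of balls over an ordered field

-- Strict positivity is primitive, and `Pos-split`, `Pos-asym` and `tight` replace trichotomy, so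
-- that the Cauchy reals are an instance without excluded middle. The map `rationals` supplies
-- coefficients to the ring solver.
record StablyOrderedField : Set₁ where
  field
    commutativeRing : CommutativeRing 0ℓ 0ℓ

  open CommutativeRing commutativeRing public
    hiding (zero)

  field
    rationals : ℚP.+-*-rawRing ACR.-Raw-AlmostCommutative⟶
                ACR.fromCommutativeRing commutativeRing
    Pos       : Pred Carrier 0ℓ
    Pos-resp  : ∀ {x y} → x ≈ y → Pos x → Pos y
    Pos-1     : Pos 1#
    Pos-+     : ∀ {x y} → Pos x → Pos y → Pos (x + y)
    Pos-*     : ∀ {x y} → Pos x → Pos y → Pos (x * y)
    Pos-split : ∀ {x y} → Pos (x + y) → Pos x ⊎ Pos y
    Pos-asym  : ∀ {x} → Pos x → ¬ Pos (- x)
    tight     : ∀ {x} → ¬ Pos x → ¬ Pos (- x) → x ≈ 0#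
    inverse   : ∀ {x} → Pos x → ∃[ y ] x * y ≈ 1#

  -- A negative statement, so that every inequality x ≤ y, in the form
  -- NonNeg (y - x), may be proved by classical reasoning.
  NonNeg : Pred Carrier 0ℓ
  NonNeg x = ¬ Pos (- x)

module Geometry (F : StablyOrderedField) where

  open StablyOrderedField F
  open MonoidSum +-commutativeMonoid public
    using (sum; sum-cong-≋; ∑-distrib-+)
  open SemiringSum semiring public using (*-distribˡ-sum)

  private
    _coeff≟_ : WeaklyDecidable (ACR.Induced-equivalence rationals)
    p coeff≟ q with p ℚP.≟ q
    ... | yes ≡.refl = just refl
    ... | no  _      = nothing

  open RingSolver ℚP.+-*-rawRing (ACR.fromCommutativeRing commutativeRing) rationals _coeff≟_
    using (solve; _:=_; _:+_; _:*_; _:-_; :-_; _:^_; con) public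
  open SetoidReasoning setoid

  -- As an empty power this polynomial evaluates to `1#` itself; the constant `1ℚ` would evaluate to
  -- its image under `rationals`, which agrees with `1#` only up to `≈`.
  :1 : ∀ {n} → RingSolver.Polynomial ℚP.+-*-rawRing
         (ACR.fromCommutativeRing commutativeRing) rationals _coeff≟_ n
  :1 = con ℚ.0ℚ :^ 0

  rational-zero : ACR._-Raw-AlmostCommutative⟶_.⟦_⟧ rationals 0ℚ ≈ 0#
  rational-zero = ACR._-Raw-AlmostCommutative⟶_.0-homo rationals

  -- Signs in a stably ordered field

  -0≈0 : - 0# ≈ 0#
  -0≈0 = trans (sym (+-identityˡ (- 0#))) (-‿inverseʳ 0#)

  ¬Pos-0 : ¬ Pos 0#
  ¬Pos-0 p = Pos-asym p (Pos-resp (sym -0≈0) p)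

  NonNeg-resp : ∀ {x y} → x ≈ y → NonNeg x → NonNeg y
  NonNeg-resp x≈y nx p = nx (Pos-resp (-‿cong (sym x≈y)) p)

  Pos⇒NonNeg : ∀ {x} → Pos x → NonNeg x
  Pos⇒NonNeg = Pos-asym

  NonNeg-0 : NonNeg 0#
  NonNeg-0 p = ¬Pos-0 (Pos-resp -0≈0 p)

  Pos+NonNeg : ∀ {x y} → Pos x → NonNeg y → Pos (x + y)
  Pos+NonNeg {x} {y} px ny = [ (λ p → p) , (λ p → contradiction p ny) ]′
    (Pos-split (Pos-resp (solve 2 (λ x y → x := (x :+ y) :+ :- y) refl x y) px))

  NonNeg-+ : ∀ {x y} → NonNeg x → NonNeg y → NonNeg (x + y)
  NonNeg-+ {x} {y} nx ny p =
    [ nx , ny ]′ (Pos-split (Pos-resp (solve 2 (λ x y → :- (x :+ y) := :- x :+ :- y) refl x y) p))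

  -- Suppose the product is negative. A positive `x` would leave `y` neither positive nor negative,
  -- hence zero by `tight`; so `x` is not positive and vanishes itself. Either way the product is
  -- zero.
  NonNeg-* : ∀ {x y} → NonNeg x → NonNeg y → NonNeg (x * y)
  NonNeg-* {x} {y} nx ny p = vanishing (trans (*-congʳ (tight ¬px nx)) (zeroˡ y))
    where
    vanishing : ¬ (x * y ≈ 0#)
    vanishing xy≈0 = NonNeg-0 (Pos-resp (-‿cong xy≈0) p)
    ¬px : ¬ Pos x
    ¬px px = vanishing (trans (*-congˡ (tight (λ py → Pos-asym (Pos-* px py) p) ny)) (zeroʳ x))

  NonNeg-sq : ∀ x → NonNeg (x * x)
  NonNeg-sq x p = NonNeg-0 (Pos-resp (-‿cong (trans (*-congʳ x≈0) (zeroˡ x))) p)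
    where
    x≈0 : x ≈ 0#
    x≈0 = tight (λ px → Pos-asym (Pos-* px px) p)
                (λ pn → Pos-asym (Pos-resp (solve 1 (λ x → :- x :* :- x := x :* x) refl x)
                                           (Pos-* pn pn)) p)

  contradict : ∀ {x y} → Pos x → NonNeg y → ¬ (x + y ≈ 0#)
  contradict px ny eq = ¬Pos-0 (Pos-resp eq (Pos+NonNeg px ny))

  -- If `y - r` were positive, so would be `y + r = (y - r) + (r + r)`, and their product
  -- contradicts the hypothesis on squares.
  NonNeg-cancel-sq : ∀ {r y} → NonNeg r → NonNeg (r * r - y * y) → NonNeg (r - y)
  NonNeg-cancel-sq {r} {y} nr nsq p = contradict
    (Pos-* p (Pos+NonNeg p (NonNeg-+ nr nr))) nsq
    (trans (solve 2 (λ r y → :- (r :- y) :* (:- (r :- y) :+ (r :+ r)) :+ (r :* r :- y :* y)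
                      := con ℚ.0ℚ) refl r y)
           rational-zero)

  NonNeg-half : ∀ {x} → NonNeg (x + x) → NonNeg x
  NonNeg-half {x} n p = n (Pos-resp
    (solve 1 (λ x → :- x :+ :- x := :- (x :+ x)) refl x) (Pos-+ p p))

  NonNeg-sum : ∀ {m} (v : Vector Carrier m) → (∀ i → NonNeg (v i)) → NonNeg (sum v)
  NonNeg-sum {ℕ.zero}  v n = NonNeg-0
  NonNeg-sum {ℕ.suc m} v n = NonNeg-+ (n zero) (NonNeg-sum (v ∘ suc) (n ∘ suc))

  -- Inner products

  Tuple : ℕ → Set
  Tuple = Vector Carrier

  dot : ∀ {t} → Tuple t → Tuple t → Carrier
  dot u v = sum (λ j → u j * v j)

  infixl 6 _⊕_ _⊖_
  infixr 7 _⊙_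
  _⊕_ _⊖_ : ∀ {t} → Tuple t → Tuple t → Tuple t
  (u ⊕ v) j = u j + v j
  (u ⊖ v) j = u j - v j

  _⊙_ : ∀ {t} → Carrier → Tuple t → Tuple t
  (α ⊙ v) j = α * v j

  dot-cong : ∀ {t} {u u′ v v′ : Tuple t} → (∀ j → u j ≈ u′ j) → (∀ j → v j ≈ v′ j) →
             dot u v ≈ dot u′ v′
  dot-cong u≈ v≈ = sum-cong-≋ (λ j → *-cong (u≈ j) (v≈ j))

  dot-comm : ∀ {t} (u v : Tuple t) → dot u v ≈ dot v u
  dot-comm u v = sum-cong-≋ (λ j → *-comm (u j) (v j))

  dot-⊕ʳ : ∀ {t} (u v w : Tuple t) → dot u (v ⊕ w) ≈ dot u v + dot u w
  dot-⊕ʳ u v w = trans (sum-cong-≋ (λ j → distribˡ (u j) (v j) (w j)))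
    (∑-distrib-+ (λ j → u j * v j) (λ j → u j * w j))

  dot-⊙ʳ : ∀ {t} α (u v : Tuple t) → dot u (α ⊙ v) ≈ α * dot u v
  dot-⊙ʳ α u v = trans
    (sum-cong-≋ (λ j → solve 3 (λ a u v → u :* (a :* v) := a :* (u :* v)) refl α (u j) (v j)))
    (sym (*-distribˡ-sum α (λ j → u j * v j)))

  dot-linʳ : ∀ {t} α β (u v w : Tuple t) →
             dot u (α ⊙ v ⊕ β ⊙ w) ≈ α * dot u v + β * dot u w
  dot-linʳ α β u v w = trans (dot-⊕ʳ u (α ⊙ v) (β ⊙ w)) (+-cong (dot-⊙ʳ α u v) (dot-⊙ʳ β u w))

  dot-linˡ : ∀ {t} α β (v w u : Tuple t) →
             dot (α ⊙ v ⊕ β ⊙ w) u ≈ α * dot v u + β * dot w u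
  dot-linˡ α β v w u = begin
    dot (α ⊙ v ⊕ β ⊙ w) u      ≈⟨ dot-comm (α ⊙ v ⊕ β ⊙ w) u ⟩
    dot u (α ⊙ v ⊕ β ⊙ w)      ≈⟨ dot-linʳ α β u v w ⟩
    α * dot u v + β * dot u w  ≈⟨ +-cong (*-congˡ (dot-comm u v)) (*-congˡ (dot-comm u w)) ⟩
    α * dot v u + β * dot w u  ∎

  normSq : ∀ {t} → Tuple t → Carrier
  normSq v = dot v v

  normSq-lin : ∀ {t} α β (v w : Tuple t) → normSq (α ⊙ v ⊕ β ⊙ w) ≈
    α * α * normSq v + (α * β + α * β) * dot v w + β * β * normSq w
  normSq-lin α β v w = begin
    normSq (α ⊙ v ⊕ β ⊙ w)
      ≈⟨ dot-linˡ α β v w (α ⊙ v ⊕ β ⊙ w) ⟩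
    α * dot v (α ⊙ v ⊕ β ⊙ w) + β * dot w (α ⊙ v ⊕ β ⊙ w)
      ≈⟨ +-cong (*-congˡ (dot-linʳ α β v v w))
                (*-congˡ (trans (dot-linʳ α β w v w) (+-congʳ (*-congˡ (dot-comm w v))))) ⟩
    α * (α * normSq v + β * dot v w) + β * (α * dot v w + β * normSq w)
      ≈⟨ solve 5 (λ a b p q r → a :* (a :* p :+ b :* q) :+ b :* (a :* q :+ b :* r) :=
           a :* a :* p :+ (a :* b :+ a :* b) :* q :+ b :* b :* r) refl α β _ _ _ ⟩
    α * α * normSq v + (α * β + α * β) * dot v w + β * β * normSq w ∎

  NonNeg-normSq : ∀ {t} (v : Tuple t) → NonNeg (normSq v)
  NonNeg-normSq v = NonNeg-sum _ (λ j → NonNeg-sq (v j))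

  -- The quadratic form `normSq (α ⊙ v ⊕ β ⊙ w)` is nonnegative. If `P` is positive, its value
  -- `P * (P * Q - θ * θ)` at `(- θ , P)` suffices. If `P` vanishes, its value at `(- (Q + 1#) , θ)`
  -- is `-(Q + 2) θ²`, which forces `θ` to vanish.
  cauchySchwarz : ∀ {t} (v w : Tuple t) →
                  NonNeg (normSq v * normSq w - dot v w * dot v w)
  cauchySchwarz v w p = degenerate (tight nondegenerate (NonNeg-normSq v))
    where
    P = normSq v
    Q = normSq w
    θ = dot v w
    form : ∀ α β → NonNeg (α * α * P + (α * β + α * β) * θ + β * β * Q)
    form α β = NonNeg-resp (normSq-lin α β v w) (NonNeg-normSq (α ⊙ v ⊕ β ⊙ w))
    nondegenerate : ¬ Pos P
    nondegenerate pP = contradict (Pos-* pP p) (form (- θ) P)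
      (trans (solve 3 (λ P Q θ → P :* :- (P :* Q :- θ :* θ) :+
                (:- θ :* :- θ :* P :+ (:- θ :* P :+ :- θ :* P) :* θ :+ P :* P :* Q)
                := con ℚ.0ℚ) refl P Q θ)
             rational-zero)
    degenerate : ¬ (P ≈ 0#)
    degenerate P≈0 = contradict
      (Pos+NonNeg (Pos-+ Pos-θ² Pos-θ²) (NonNeg-* (NonNeg-normSq w) (NonNeg-sq θ)))
      (form (- (Q + 1#)) θ)
      (begin
        θ * θ + θ * θ + Q * (θ * θ) +
          ((- (Q + 1#)) * (- (Q + 1#)) * P + ((- (Q + 1#)) * θ + (- (Q + 1#)) * θ) * θ + θ * θ * Q)
          ≈⟨ solve 3 (λ P Q θ → θ :* θ :+ θ :* θ :+ Q :* (θ :* θ) :+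
               (:- (Q :+ :1) :* :- (Q :+ :1) :* P :+
                (:- (Q :+ :1) :* θ :+ :- (Q :+ :1) :* θ) :* θ :+ θ :* θ :* Q) :=
               (Q :+ :1) :* (Q :+ :1) :* P) refl P Q θ ⟩
        (Q + 1#) * (Q + 1#) * P ≈⟨ *-congˡ P≈0 ⟩
        (Q + 1#) * (Q + 1#) * 0# ≈⟨ zeroʳ _ ⟩
        0# ∎)
      where
      Pos-θ² : Pos (θ * θ)
      Pos-θ² = Pos-resp (begin
        - (P * Q - θ * θ)
          ≈⟨ solve 3 (λ P Q θ → :- (P :* Q :- θ :* θ) := θ :* θ :- P :* Q) refl P Q θ ⟩
        θ * θ - P * Q       ≈⟨ +-congˡ (-‿cong (trans (*-congʳ P≈0) (zeroˡ Q))) ⟩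
        θ * θ - 0#          ≈⟨ +-congˡ -0≈0 ⟩
        θ * θ + 0#          ≈⟨ +-identityʳ _ ⟩
        θ * θ               ∎) p

  -- By Cauchy-Schwarz a vanishing `normSq v` would make `dot d v` vanish. The double negation is
  -- harmless, because it is only used towards negative goals.
  nonorthogonal⇒nonzero : ∀ {t} (d v : Tuple t) → Pos (dot d v) → ¬ ¬ Pos (normSq v)
  nonorthogonal⇒nonzero d v p ¬p = contradict (Pos-* p p) (cauchySchwarz d v) (begin
    dot d v * dot d v + (normSq d * normSq v - dot d v * dot d v)
      ≈⟨ solve 2 (λ a b → a :+ (b :- a) := b) refl _ _ ⟩
    normSq d * normSq v ≈⟨ *-congˡ (tight ¬p (NonNeg-normSq v)) ⟩
    normSq d * 0#       ≈⟨ zeroʳ _ ⟩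
    0#                  ∎)

  Unit : ∀ {t} → Tuple t → Set
  Unit u = normSq u ≈ 1#

  dot≤product : ∀ {t} {α β} (v w : Tuple t) → NonNeg α → NonNeg β →
                NonNeg (α * α - normSq v) → NonNeg (β * β - normSq w) →
                NonNeg (α * β - dot v w)
  dot≤product {α = α} {β} v w nα nβ v≤α w≤β = NonNeg-cancel-sq (NonNeg-* nα nβ)
    (NonNeg-resp
      (solve 5 (λ α β P Q θ → α :* α :* (β :* β :- Q) :+ Q :* (α :* α :- P) :+ (P :* Q :- θ :* θ) :=
        α :* β :* (α :* β) :- θ :* θ) refl α β (normSq v) (normSq w) (dot v w))
      (NonNeg-+ (NonNeg-+ (NonNeg-* (NonNeg-sq α) w≤β) (NonNeg-* (NonNeg-normSq w) v≤α))
                (cauchySchwarz v w)))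

  -- Balls, convex hulls and support functions

  InBall : ∀ {t} → Tuple t → Carrier → Pred (Tuple t) 0ℓ
  InBall c r p = NonNeg (r * r - normSq (p ⊖ c))

  InHull : ∀ {t} → Pred (Tuple t) 0ℓ → Pred (Tuple t) 0ℓ
  InHull {t} S p = ∃[ m ] Σ[ q ∈ (Fin m → Tuple t) ] Σ[ w ∈ Vector Carrier m ]
    (∀ i → S (q i)) × (∀ i → NonNeg (w i)) × sum w ≈ 1# ×
    (∀ j → p j ≈ sum (λ i → w i * q i j))

  -- The value at u of the support function of the ball, for unit vectors u.
  support : ∀ {t} → Tuple t → Carrier → Tuple t → Carrier
  support c r u = dot c u + r

  dot-⊖ʳ : ∀ {t} (u v w : Tuple t) → dot u (v ⊖ w) ≈ dot u v - dot u w
  dot-⊖ʳ u v w = begin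
    dot u (v ⊖ w)
      ≈⟨ dot-cong {u = u} (λ _ → refl) (λ j → solve 2 (λ v w → v :- w := :1 :* v :+ :- :1 :* w)
           refl (v j) (w j)) ⟩
    dot u (1# ⊙ v ⊕ (- 1#) ⊙ w)        ≈⟨ dot-linʳ 1# (- 1#) u v w ⟩
    1# * dot u v + (- 1#) * dot u w
      ≈⟨ solve 2 (λ v w → :1 :* v :+ :- :1 :* w := v :- w) refl _ _ ⟩
    dot u v - dot u w ∎

  ball≤support : ∀ {t c r} {u q : Tuple t} → Unit u → NonNeg r → InBall c r q →
                 NonNeg (support c r u - dot u q)
  ball≤support {c = c} {r} {u} {q} unit nr q∈ = NonNeg-resp
    (begin
      1# * r - dot u (q ⊖ c)         ≈⟨ +-congˡ (-‿cong (dot-⊖ʳ u q c)) ⟩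
      1# * r - (dot u q - dot u c)   ≈⟨ +-congˡ (-‿cong (+-congˡ (-‿cong (dot-comm u c)))) ⟩
      1# * r - (dot u q - dot c u)
        ≈⟨ solve 3 (λ r a b → :1 :* r :- (a :- b) := b :+ r :- a) refl r (dot u q) (dot c u) ⟩
      support c r u - dot u q        ∎)
    (dot≤product u (q ⊖ c) (Pos⇒NonNeg Pos-1) nr
      (NonNeg-resp (trans (sym rational-zero)
        (trans (solve 1 (λ a → con ℚ.0ℚ := :1 :* a :- a) refl 1#)
               (+-congˡ (-‿cong (sym unit))))) NonNeg-0)
      q∈)

  hull≤bound : ∀ {t S p M} {u : Tuple t} → InHull S p →
               (∀ q → S q → NonNeg (M - dot u q)) → NonNeg (M - dot u p)
  hull≤bound {t} {S} {p} {M} {u} (m , q , w , q∈S , w≥0 , Σw≈1 , p≈) bound = NonNeg-resp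
    (begin
      sum (λ i → w i * (M - dot u (q i)))  ≈⟨ weighted w q ⟩
      sum w * M - dot u (λ j → sum (λ i → w i * q i j))
        ≈⟨ +-cong (trans (*-congʳ Σw≈1) (*-identityˡ M))
                  (-‿cong (dot-cong {u = u} (λ _ → refl) (λ j → sym (p≈ j)))) ⟩
      M - dot u p ∎)
    (NonNeg-sum _ (λ i → NonNeg-* (w≥0 i) (bound (q i) (q∈S i))))
    where
    weighted : ∀ {m} (w : Vector Carrier m) (q : Fin m → Tuple t) →
      sum (λ i → w i * (M - dot u (q i))) ≈ sum w * M - dot u (λ j → sum (λ i → w i * q i j))
    weighted {ℕ.zero} w q = sym (begin
      0# * M - dot u (λ _ → 0#)
        ≈⟨ +-congˡ (-‿cong (trans (dot-cong {u = u} (λ _ → refl) (λ j → sym (zeroˡ (u j))))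
             (dot-⊙ʳ 0# u u))) ⟩
      0# * M - 0# * dot u u
        ≈⟨ solve 3 (λ z M d → z :* M :- z :* d := z :* (M :- d)) refl 0# M _ ⟩
      0# * (M - dot u u)   ≈⟨ zeroˡ _ ⟩
      0# ∎)
    weighted {ℕ.suc m} w q = begin
      w zero * (M - dot u (q zero)) + sum (λ i → w (suc i) * (M - dot u (q (suc i))))
        ≈⟨ +-congˡ (weighted (w ∘ suc) (q ∘ suc)) ⟩
      w zero * (M - dot u (q zero)) + (sum (w ∘ suc) * M - dot u rest)
        ≈⟨ solve 5 (λ a s M d e → a :* (M :- d) :+ (s :* M :- e) :=
             (a :+ s) :* M :- (a :* d :+ e)) refl (w zero) (sum (w ∘ suc)) M _ _ ⟩
      sum w * M - (w zero * dot u (q zero) + dot u rest)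
        ≈⟨ +-congˡ (-‿cong (sym (trans (dot-⊕ʳ u (w zero ⊙ q zero) rest)
             (+-congʳ (dot-⊙ʳ (w zero) u (q zero)))))) ⟩
      sum w * M - dot u (w zero ⊙ q zero ⊕ rest) ∎
      where
      rest : Tuple t
      rest j = sum (λ i → w (suc i) * q (suc i) j)

  -- The support value is attained at the point `c ⊕ r ⊙ u` of the ball, and a linear bound on `S`
  -- passes to its convex hull.
  inHull⇒support≤ : ∀ {t S c r M} {u : Tuple t} → Unit u →
    (∀ p → InBall c r p → InHull S p) →
    (∀ q → S q → NonNeg (M - dot u q)) → NonNeg (M - support c r u)
  inHull⇒support≤ {S = S} {c} {r} {M} {u} unit sub bound =
    NonNeg-resp (+-congˡ (-‿cong top-value)) (hull≤bound {M = M} (sub top top∈) bound)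
    where
    top = c ⊕ r ⊙ u
    top-value : dot u top ≈ support c r u
    top-value = begin
      dot u top            ≈⟨ dot-⊕ʳ u c (r ⊙ u) ⟩
      dot u c + dot u (r ⊙ u)
        ≈⟨ +-cong (dot-comm u c) (trans (dot-⊙ʳ r u u) (trans (*-congˡ unit) (*-identityʳ r))) ⟩
      support c r u        ∎
    top∈ : InBall c r top
    top∈ = NonNeg-resp (begin
      0#                             ≈⟨ sym (-‿inverseʳ (r * r)) ⟩
      r * r - r * r                  ≈⟨ +-congˡ (-‿cong (sym (begin
        normSq (top ⊖ c)
          ≈⟨ dot-cong shift shift ⟩
        dot (r ⊙ u) (r ⊙ u)            ≈⟨ dot-⊙ʳ r (r ⊙ u) u ⟩
        r * dot (r ⊙ u) u              ≈⟨ *-congˡ (trans (dot-comm (r ⊙ u) u) (dot-⊙ʳ r u u)) ⟩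
        r * (r * normSq u)             ≈⟨ *-congˡ (trans (*-congˡ unit) (*-identityʳ r)) ⟩
        r * r                          ∎))) ⟩
      r * r - normSq (top ⊖ c)       ∎) NonNeg-0
      where
      shift : ∀ j → (top ⊖ c) j ≈ (r ⊙ u) j
      shift j = solve 2 (λ c x → c :+ x :- c := x) refl (c j) (r * u j)

  NonNeg-transitive : ∀ x y z → NonNeg (x - y) → NonNeg (y - z) → NonNeg (x - z)
  NonNeg-transitive x y z x≥y y≥z = NonNeg-resp
    (solve 3 (λ x y z → (x :- y) :+ (y :- z) := x :- z) refl x y z) (NonNeg-+ x≥y y≥z)

  Pos-swap : ∀ x y → Pos (- (x - y)) → Pos (y - x)
  Pos-swap x y = Pos-resp (solve 2 (λ x y → :- (x :- y) := y :- x) refl x y)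

  -- Affine functions that are nonnegative on the unit sphere

  e₁ : ∀ t → Tuple (ℕ.suc t)
  e₁ t zero    = 1#
  e₁ t (suc _) = 0#

  dot-e₁ : ∀ {t} (v : Tuple (ℕ.suc t)) → dot (e₁ t) v ≈ v zero
  dot-e₁ {t} v = begin
    1# * v zero + sum (λ j → 0# * v (suc j))
      ≈⟨ +-cong (*-identityˡ _) (trans (sym (*-distribˡ-sum 0# (v ∘ suc))) (zeroˡ _)) ⟩
    v zero + 0#  ≈⟨ +-identityʳ _ ⟩
    v zero       ∎

  -- Positive dimension provides a unit vector; otherwise conditions on all unit vectors would be
  -- vacuous.
  e₁-unit : ∀ t → Unit (e₁ t)
  e₁-unit t = dot-e₁ (e₁ t)

  normalise : ∀ {t ρ} (v : Tuple t) → Pos ρ → normSq v ≈ ρ * ρ →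
              ∃[ σ ] (ρ * σ ≈ 1# × Unit (σ ⊙ v))
  normalise {ρ = ρ} v pρ v≈ = σ , ρσ , (begin
    dot (σ ⊙ v) (σ ⊙ v)   ≈⟨ dot-⊙ʳ σ (σ ⊙ v) v ⟩
    σ * dot (σ ⊙ v) v     ≈⟨ *-congˡ (trans (dot-comm (σ ⊙ v) v) (dot-⊙ʳ σ v v)) ⟩
    σ * (σ * normSq v)    ≈⟨ *-congˡ (*-congˡ v≈) ⟩
    σ * (σ * (ρ * ρ))     ≈⟨ solve 2 (λ σ ρ → σ :* (σ :* (ρ :* ρ)) := ρ :* σ :* (ρ :* σ)) refl σ ρ ⟩
    ρ * σ * (ρ * σ)       ≈⟨ *-cong ρσ ρσ ⟩
    1# * 1#               ≈⟨ *-identityˡ 1# ⟩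
    1#                    ∎)
    where
    σ = proj₁ (inverse pρ)
    ρσ = proj₂ (inverse pρ)

  -- Evaluates the affine function at `v` divided by its length and multiplies by the length. The
  -- field has no square roots in general, so the length `ρ` has to be given.
  homogenise : ∀ {t ρ e} (d v : Tuple t) → (∀ u → Unit u → NonNeg (dot d u + e)) →
               Pos ρ → normSq v ≈ ρ * ρ → NonNeg (dot d v + ρ * e)
  homogenise {ρ = ρ} {e} d v nonneg pρ v≈ = NonNeg-resp (begin
    ρ * (dot d (σ ⊙ v) + e)    ≈⟨ *-congˡ (+-congʳ (dot-⊙ʳ σ d v)) ⟩
    ρ * (σ * dot d v + e)
      ≈⟨ solve 4 (λ ρ σ δ e → ρ :* (σ :* δ :+ e) := ρ :* σ :* δ :+ ρ :* e) refl ρ σ _ e ⟩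
    ρ * σ * dot d v + ρ * e    ≈⟨ +-congʳ (trans (*-congʳ ρσ) (*-identityˡ _)) ⟩
    dot d v + ρ * e            ∎)
    (NonNeg-* (Pos⇒NonNeg pρ) (nonneg (σ ⊙ v) unit))
    where
    σ = proj₁ (normalise v pρ v≈)
    ρσ = proj₁ (proj₂ (normalise v pρ v≈))
    unit = proj₂ (proj₂ (normalise v pρ v≈))

  module _ {t} (D : Tuple (ℕ.suc t)) (e : Carrier)
           (bound : ∀ u → Unit u → NonNeg (dot D u + e)) where

    private
      ê : Tuple (ℕ.suc t)
      ê = e₁ t
      N D₁ x : Carrier
      N = normSq D
      D₁ = - D zero
      x = e - D₁

    e-D₁≥0 : NonNeg (e - D₁)
    e-D₁≥0 = NonNeg-resp (begin
      dot D ê + e     ≈⟨ +-congʳ (trans (dot-comm D ê) (dot-e₁ D)) ⟩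
      D zero + e       ≈⟨ solve 2 (λ d e → d :+ e := e :- :- d) refl _ _ ⟩
      e - D₁           ∎) (bound ê (e₁-unit t))

    e+D₁≥0 : NonNeg (e + D₁)
    e+D₁≥0 = NonNeg-resp (begin
      dot D ((- 1#) ⊙ ê) + e   ≈⟨ +-congʳ (dot-⊙ʳ (- 1#) D ê) ⟩
      (- 1#) * dot D ê + e     ≈⟨ +-congʳ (*-congˡ (trans (dot-comm D ê) (dot-e₁ D))) ⟩
      (- 1#) * D zero + e       ≈⟨ solve 2 (λ d e → :- :1 :* d :+ e := e :+ :- d) refl _ _ ⟩
      e + D₁                    ∎) (bound ((- 1#) ⊙ ê) (begin
        normSq ((- 1#) ⊙ ê)           ≈⟨ dot-⊙ʳ (- 1#) ((- 1#) ⊙ ê) ê ⟩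
        (- 1#) * dot ((- 1#) ⊙ ê) ê
          ≈⟨ *-congˡ (trans (dot-comm ((- 1#) ⊙ ê) ê) (dot-e₁ ((- 1#) ⊙ ê))) ⟩
        (- 1#) * ((- 1#) * 1#)         ≈⟨ solve 1 (λ z → :- :1 :* (:- :1 :* :1) := :1) refl 0# ⟩
        1#                             ∎))

    -- The values at the antipodal points `ê` and its negative average to `e`.
    constant≥0 : NonNeg e
    constant≥0 = NonNeg-half (NonNeg-resp
      (solve 2 (λ e d → e :- d :+ (e :+ d) := e :+ e) refl e D₁) (NonNeg-+ e-D₁≥0 e+D₁≥0))

    -- The homogenised functional at the reflection of ê in κ ê − μ D: these
    -- vectors reach all directions without square roots.
    reflected : ∀ κ μ → Pos (κ * κ + (κ * μ + κ * μ) * D₁ + μ * μ * N) →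
                NonNeg (κ * κ * x - (κ * μ + κ * μ) * (N - e * D₁) + μ * μ * (N * x))
    reflected κ μ pρ = NonNeg-resp (begin
        dot D v + ρ * e     ≈⟨ +-congʳ (dot-linʳ (ω + ω) (- ρ) D w ê) ⟩
        (ω + ω) * dot D w + - ρ * dot D ê + ρ * e
          ≈⟨ +-congʳ (+-cong (*-congˡ D·w) (*-congˡ D·ê)) ⟩
        (ω + ω) * (κ * - D₁ + - μ * N) + - ρ * - D₁ + ρ * e
          ≈⟨ solve 5 (λ κ μ N D₁ e →
               let ω = κ :+ μ :* D₁
                   ρ = κ :* κ :+ (κ :* μ :+ κ :* μ) :* D₁ :+ μ :* μ :* N
               in (ω :+ ω) :* (κ :* :- D₁ :+ :- μ :* N) :+ :- ρ :* :- D₁ :+ ρ :* e :=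
                  κ :* κ :* (e :- D₁) :- (κ :* μ :+ κ :* μ) :* (N :- e :* D₁)
                    :+ μ :* μ :* (N :* (e :- D₁)))
               refl κ μ N D₁ e ⟩
        κ * κ * x - (κ * μ + κ * μ) * (N - e * D₁) + μ * μ * (N * x) ∎)
      (homogenise D v bound pρ v²)
      where
      ρ ω : Carrier
      ρ = κ * κ + (κ * μ + κ * μ) * D₁ + μ * μ * N
      ω = κ + μ * D₁
      -- `v` is `normSq w` times the reflection of `ê` in the line through `w`, so its length is the
      -- ring expression `ρ`.
      w v : Tuple (ℕ.suc t)
      w = κ ⊙ ê ⊕ (- μ) ⊙ D
      v = (ω + ω) ⊙ w ⊕ (- ρ) ⊙ ê
      D·ê : dot D ê ≈ - D₁
      D·ê = trans (dot-comm D ê) (trans (dot-e₁ D) (solve 1 (λ d → d := :- :- d) refl _))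
      D·w : dot D w ≈ κ * - D₁ + - μ * N
      D·w = trans (dot-linʳ κ (- μ) D ê D) (+-congʳ (*-congˡ D·ê))
      w·ê : dot w ê ≈ ω
      w·ê = begin
        dot w ê                          ≈⟨ dot-linˡ κ (- μ) ê D ê ⟩
        κ * normSq ê + - μ * dot D ê    ≈⟨ +-cong (*-congˡ (e₁-unit t)) (*-congˡ D·ê) ⟩
        κ * 1# + - μ * - D₁
          ≈⟨ solve 3 (λ κ μ d → κ :* :1 :+ :- μ :* :- d := κ :+ μ :* d) refl κ μ D₁ ⟩
        ω                                 ∎
      w² : normSq w ≈ ρ
      w² = begin
        normSq w ≈⟨ normSq-lin κ (- μ) ê D ⟩
        κ * κ * normSq ê + (κ * - μ + κ * - μ) * dot ê D + - μ * - μ * N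
          ≈⟨ +-congʳ (+-cong (*-congˡ (e₁-unit t)) (*-congˡ (trans (dot-comm ê D) D·ê))) ⟩
        κ * κ * 1# + (κ * - μ + κ * - μ) * - D₁ + - μ * - μ * N
          ≈⟨ solve 4 (λ κ μ d N → κ :* κ :* :1 :+ (κ :* :- μ :+ κ :* :- μ) :* :- d :+ :- μ :* :- μ :* N
               := κ :* κ :+ (κ :* μ :+ κ :* μ) :* d :+ μ :* μ :* N) refl κ μ D₁ N ⟩
        ρ ∎
      v² : normSq v ≈ ρ * ρ
      v² = begin
        normSq v ≈⟨ normSq-lin (ω + ω) (- ρ) w ê ⟩
        (ω + ω) * (ω + ω) * normSq w + ((ω + ω) * - ρ + (ω + ω) * - ρ) * dot w ê + - ρ * - ρ * normSq ê
          ≈⟨ +-cong (+-cong (*-congˡ w²) (*-congˡ w·ê)) (*-congˡ (e₁-unit t)) ⟩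
        (ω + ω) * (ω + ω) * ρ + ((ω + ω) * - ρ + (ω + ω) * - ρ) * ω + - ρ * - ρ * 1#
          ≈⟨ solve 2 (λ ω ρ → (ω :+ ω) :* (ω :+ ω) :* ρ :+ ((ω :+ ω) :* :- ρ :+ (ω :+ ω) :* :- ρ) :* ω
               :+ :- ρ :* :- ρ :* :1 := ρ :* ρ) refl ω ρ ⟩
        ρ * ρ ∎

    -- The form in `reflected` has, up to a constant factor, the discriminant `(N - e²)(N - D₁²)`.
    -- If `N` exceeded `e²`, it would exceed `D₁²` as well, and the form would be negative
    -- somewhere: at `(N - e * D₁ , x)` for positive `x`, and at `(1# , 1#)` for `x ≈ 0#`.
    normSq≤constant : NonNeg (e * e - normSq D)
    normSq≤constant p = degenerate (tight nondegenerate e-D₁≥0)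
      where
      N-D₁² : Pos (N - D₁ * D₁)
      N-D₁² = Pos-resp (solve 3 (λ e N d → :- (e :* e :- N) :+ (e :- d) :* (e :+ d) := N :- d :* d)
                          refl e N D₁)
        (Pos+NonNeg p (NonNeg-* e-D₁≥0 e+D₁≥0))
      nondegenerate : ¬ Pos x
      nondegenerate px = contradict (Pos-* (Pos-* px p) N-D₁²)
        (reflected (N - e * D₁) x (Pos-resp
          (solve 3 (λ N e d → let x = e :- d ; κ = N :- e :* d in
             x :* x :* (N :- d :* d) :+ (κ :+ x :* d) :* (κ :+ x :* d) :=
             κ :* κ :+ (κ :* x :+ κ :* x) :* d :+ x :* x :* N) refl N e D₁)
          (Pos+NonNeg (Pos-* (Pos-* px px) N-D₁²) (NonNeg-sq (N - e * D₁ + x * D₁)))))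
        (trans (solve 3 (λ N e d → let x = e :- d ; κ = N :- e :* d in
             x :* :- (e :* e :- N) :* (N :- d :* d) :+
             (κ :* κ :* x :- (κ :* x :+ κ :* x) :* κ :+ x :* x :* (N :* x)) := con ℚ.0ℚ)
             refl N e D₁) rational-zero)
      degenerate : ¬ (x ≈ 0#)
      degenerate x≈0 = contradict (Pos-+ p p)
        (reflected 1# 1# (Pos-resp
          (solve 2 (λ N d → N :- d :* d :+ (:1 :+ d) :* (:1 :+ d) :=
             :1 :* :1 :+ (:1 :* :1 :+ :1 :* :1) :* d :+ :1 :* :1 :* N) refl N D₁)
          (Pos+NonNeg N-D₁² (NonNeg-sq (1# + D₁)))))
        (begin
          - (e * e - N) + - (e * e - N) +
            (1# * 1# * x - (1# * 1# + 1# * 1#) * (N - e * D₁) + 1# * 1# * (N * x))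
            ≈⟨ solve 3 (λ N e d → let x = e :- d in
                 :- (e :* e :- N) :+ :- (e :* e :- N) :+
                 (:1 :* :1 :* x :- (:1 :* :1 :+ :1 :* :1) :* (N :- e :* d) :+ :1 :* :1 :* (N :* x))
                 := (:1 :+ N :- (e :+ e)) :* x) refl N e D₁ ⟩
          (1# + N - (e + e)) * x    ≈⟨ *-congˡ x≈0 ⟩
          (1# + N - (e + e)) * 0#   ≈⟨ zeroʳ _ ⟩
          0#                        ∎)

  support-⊖ : ∀ {t} (c c′ : Tuple t) r r′ u →
    support (c′ ⊖ c) (r′ - r) u ≈ support c′ r′ u - support c r u
  support-⊖ c c′ r r′ u = begin
    dot (c′ ⊖ c) u + (r′ - r)
      ≈⟨ +-congʳ (trans (dot-comm (c′ ⊖ c) u) (trans (dot-⊖ʳ u c′ c)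
           (+-cong (dot-comm u c′) (-‿cong (dot-comm u c))))) ⟩
    (dot c′ u - dot c u) + (r′ - r)
      ≈⟨ solve 4 (λ a r′ b r → (a :- b) :+ (r′ :- r) := (a :+ r′) :- (b :+ r)) refl _ r′ _ r ⟩
    support c′ r′ u - support c r u ∎

  -- The difference of the support functions is affine on the sphere, so `normSq≤constant` bounds
  -- the distance of the centres by `r′ - r`. The rest is the triangle inequality in squared form,
  -- with Cauchy-Schwarz for the cross term.
  support≤⇒ball⊆ : ∀ {t} {c c′ : Tuple (ℕ.suc t)} {r r′} → NonNeg r →
    (∀ u → Unit u → NonNeg (support c′ r′ u - support c r u)) →
    ∀ p → InBall c r p → InBall c′ r′ p
  support≤⇒ball⊆ {c = c} {c′} {r} {r′} nr bound p p∈ = NonNeg-resp (begin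
      ((r * r - normSq (p ⊖ c)) + (e * e - normSq D)) +
        ((r * e - dot (p ⊖ c) ⊖D) + (r * e - dot (p ⊖ c) ⊖D))
        ≈⟨ +-congˡ (+-cong flip flip) ⟩
      ((r * r - normSq (p ⊖ c)) + (e * e - normSq D)) +
        ((r * e + dot (p ⊖ c) D) + (r * e + dot (p ⊖ c) D))
        ≈⟨ solve 5 (λ r r′ P N θ → let e = r′ :- r in
             ((r :* r :- P) :+ (e :* e :- N)) :+ ((r :* e :+ θ) :+ (r :* e :+ θ)) :=
             r′ :* r′ :- (:1 :* :1 :* P :+
               (:1 :* :- :1 :+ :1 :* :- :1) :* θ :+ :- :1 :* :- :1 :* N))
             refl r r′ (normSq (p ⊖ c)) (normSq D) (dot (p ⊖ c) D) ⟩
      r′ * r′ - (1# * 1# * normSq (p ⊖ c) +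
        (1# * - 1# + 1# * - 1#) * dot (p ⊖ c) D + - 1# * - 1# * normSq D)
        ≈⟨ +-congˡ (-‿cong (sym (normSq-lin 1# (- 1#) (p ⊖ c) D))) ⟩
      r′ * r′ - normSq (1# ⊙ (p ⊖ c) ⊕ (- 1#) ⊙ D)
        ≈⟨ +-congˡ (-‿cong (dot-cong shift shift)) ⟩
      r′ * r′ - normSq (p ⊖ c′) ∎)
    (NonNeg-+ (NonNeg-+ p∈ D≤e) (NonNeg-+ crossTerm crossTerm))
    where
    D = c′ ⊖ c
    ⊖D = (- 1#) ⊙ D
    e = r′ - r
    affine : ∀ u → Unit u → NonNeg (dot D u + e)
    affine u unit = NonNeg-resp (sym (support-⊖ c c′ r r′ u)) (bound u unit)
    D≤e = normSq≤constant D e affine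
    ⊖D≤e : NonNeg (e * e - normSq ⊖D)
    ⊖D≤e = NonNeg-resp (+-congˡ (-‿cong (sym (begin
      normSq ⊖D                  ≈⟨ dot-⊙ʳ (- 1#) ⊖D D ⟩
      - 1# * dot ⊖D D            ≈⟨ *-congˡ (trans (dot-comm ⊖D D) (dot-⊙ʳ (- 1#) D D)) ⟩
      - 1# * (- 1# * normSq D)   ≈⟨ solve 1 (λ a → :- :1 :* (:- :1 :* a) := a) refl _ ⟩
      normSq D                   ∎)))) D≤e
    crossTerm = dot≤product (p ⊖ c) ⊖D nr (constant≥0 D e affine) p∈ ⊖D≤e
    flip : r * e - dot (p ⊖ c) ⊖D ≈ r * e + dot (p ⊖ c) D
    flip = trans (+-congˡ (-‿cong (dot-⊙ʳ (- 1#) (p ⊖ c) D)))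
      (solve 2 (λ a b → a :- :- :1 :* b := a :+ b) refl _ _)
    shift : ∀ j → (1# ⊙ (p ⊖ c) ⊕ (- 1#) ⊙ D) j ≈ (p ⊖ c′) j
    shift j = solve 3 (λ p c c′ → :1 :* (p :- c) :+ :- :1 :* (c′ :- c) := p :- c′)
      refl (p j) (c j) (c′ j)

  -- The inequality for three unit vectors

  module _ {t} {A B C : Tuple t} (unitA : Unit A) (unitB : Unit B) (unitC : Unit C) where

    private
      -- For unit vectors, `kA`, `kB` and `kC` are half the squared sides of the triangle `A`, `B`,
      -- `C`, and `s` is half the squared length of `z`, which is twice the median vector from `A`.
      kA kB kC s : Carrier
      kA = 1# - dot B C
      kB = 1# - dot C A
      kC = 1# - dot A B
      s = kB + kB + (kC + kC) - kA
      z w : Tuple t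
      z = 1# ⊙ (1# ⊙ B ⊕ 1# ⊙ C) ⊕ (- (1# + 1#)) ⊙ A
      w = 1# ⊙ ((kB + kB) ⊙ B ⊕ (kC + kC) ⊙ C) ⊕ (- kA) ⊙ A

    midpoint-normSq : normSq z ≈ s + s
    midpoint-normSq = begin
      normSq z
        ≈⟨ normSq-lin 1# (- (1# + 1#)) (1# ⊙ B ⊕ 1# ⊙ C) A ⟩
      1# * 1# * normSq (1# ⊙ B ⊕ 1# ⊙ C) +
        (1# * - (1# + 1#) + 1# * - (1# + 1#)) * dot (1# ⊙ B ⊕ 1# ⊙ C) A +
        - (1# + 1#) * - (1# + 1#) * normSq A
        ≈⟨ +-cong (+-cong (*-congˡ (trans (normSq-lin 1# 1# B C)
                    (+-cong (+-congʳ (*-congˡ unitB)) (*-congˡ unitC))))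
                  (*-congˡ (trans (dot-linˡ 1# 1# B C A) (+-congʳ (*-congˡ (dot-comm B A))))))
                  (*-congˡ unitA) ⟩
      1# * 1# * (1# * 1# * 1# + (1# * 1# + 1# * 1#) * dot B C + 1# * 1# * 1#) +
        (1# * - (1# + 1#) + 1# * - (1# + 1#)) * (1# * dot A B + 1# * dot C A) +
        - (1# + 1#) * - (1# + 1#) * 1#
        ≈⟨ solve 3 (λ bc ca ab →
             :1 :* :1 :* (:1 :* :1 :* :1 :+ (:1 :* :1 :+ :1 :* :1) :* bc :+ :1 :* :1 :* :1) :+
             (:1 :* :- (:1 :+ :1) :+ :1 :* :- (:1 :+ :1)) :* (:1 :* ab :+ :1 :* ca) :+
             :- (:1 :+ :1) :* :- (:1 :+ :1) :* :1 :=
             let s = (:1 :- ca) :+ (:1 :- ca) :+ ((:1 :- ab) :+ (:1 :- ab)) :- (:1 :- bc)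
             in s :+ s) refl (dot B C) (dot C A) (dot A B) ⟩
      s + s ∎

    -- s⁻¹ w is the second intersection of the symmedian through A with the
    -- circumcircle of A, B, C: the harmonic conjugate of A in B, C.
    harmonic-normSq : normSq w ≈ s * s
    harmonic-normSq = begin
      normSq w
        ≈⟨ normSq-lin 1# (- kA) ((kB + kB) ⊙ B ⊕ (kC + kC) ⊙ C) A ⟩
      1# * 1# * normSq ((kB + kB) ⊙ B ⊕ (kC + kC) ⊙ C) +
        (1# * - kA + 1# * - kA) * dot ((kB + kB) ⊙ B ⊕ (kC + kC) ⊙ C) A + - kA * - kA * normSq A
        ≈⟨ +-cong (+-cong (*-congˡ (trans (normSq-lin (kB + kB) (kC + kC) B C)
                    (+-cong (+-congʳ (*-congˡ unitB)) (*-congˡ unitC))))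
                  (*-congˡ (trans (dot-linˡ (kB + kB) (kC + kC) B C A)
                    (+-congʳ (*-congˡ (dot-comm B A))))))
                  (*-congˡ unitA) ⟩
      1# * 1# * ((kB + kB) * (kB + kB) * 1# +
          ((kB + kB) * (kC + kC) + (kB + kB) * (kC + kC)) * dot B C + (kC + kC) * (kC + kC) * 1#) +
        (1# * - kA + 1# * - kA) * ((kB + kB) * dot A B + (kC + kC) * dot C A) + - kA * - kA * 1#
        ≈⟨ solve 3 (λ bc ca ab →
             let a = :1 :- bc ; b = :1 :- ca ; c = :1 :- ab ; s = b :+ b :+ (c :+ c) :- a in
             :1 :* :1 :* ((b :+ b) :* (b :+ b) :* :1 :+
               ((b :+ b) :* (c :+ c) :+ (b :+ b) :* (c :+ c)) :* bc :+ (c :+ c) :* (c :+ c) :* :1) :+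
             (:1 :* :- a :+ :1 :* :- a) :* ((b :+ b) :* ab :+ (c :+ c) :* ca) :+ :- a :* :- a :* :1 :=
             s :* s) refl (dot B C) (dot C A) (dot A B) ⟩
      s * s ∎

    dot-midpoint : ∀ d → dot d z ≈ dot d B + dot d C - (dot d A + dot d A)
    dot-midpoint d = begin
      dot d z ≈⟨ dot-linʳ 1# (- (1# + 1#)) d (1# ⊙ B ⊕ 1# ⊙ C) A ⟩
      1# * dot d (1# ⊙ B ⊕ 1# ⊙ C) + - (1# + 1#) * dot d A
        ≈⟨ +-congʳ (*-congˡ (dot-linʳ 1# 1# d B C)) ⟩
      1# * (1# * dot d B + 1# * dot d C) + - (1# + 1#) * dot d A
        ≈⟨ solve 3 (λ a b c → :1 :* (:1 :* b :+ :1 :* c) :+ :- (:1 :+ :1) :* a := b :+ c :- (a :+ a))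
             refl (dot d A) (dot d B) (dot d C) ⟩
      dot d B + dot d C - (dot d A + dot d A) ∎

    -- The coefficients of `w` add up to `s`, which is also its length. Homogenising at `w`
    -- therefore gives the combination of the values at `A`, `B` and `C` with exactly these
    -- coefficients.
    casey : ∀ {d e} → Pos s → (∀ u → Unit u → NonNeg (support d e u)) →
      NonNeg (((kB * support d e B + kC * support d e C) +
               (kB * support d e B + kC * support d e C)) - kA * support d e A)
    casey {d} {e} ps nonneg = NonNeg-resp (begin
      dot d w + s * e
        ≈⟨ +-congʳ (trans (dot-linʳ 1# (- kA) d ((kB + kB) ⊙ B ⊕ (kC + kC) ⊙ C) A)
             (+-congʳ (*-congˡ (dot-linʳ (kB + kB) (kC + kC) d B C)))) ⟩
      1# * ((kB + kB) * dot d B + (kC + kC) * dot d C) + - kA * dot d A + s * e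
        ≈⟨ solve 7 (λ a b c x y z e →
             :1 :* ((b :+ b) :* y :+ (c :+ c) :* z) :+ :- a :* x :+ (b :+ b :+ (c :+ c) :- a) :* e :=
             ((b :* (y :+ e) :+ c :* (z :+ e)) :+ (b :* (y :+ e) :+ c :* (z :+ e))) :- a :* (x :+ e))
             refl kA kB kC (dot d A) (dot d B) (dot d C) e ⟩
      ((kB * support d e B + kC * support d e C) +
               (kB * support d e B + kC * support d e C)) - kA * support d e A ∎)
      (homogenise d w nonneg ps harmonic-normSq)

    -- The affine function is positive at `A` only, so `dot d z` is negative. Hence `z` is nonzero,
    -- and `s` is half its squared length.
    separated⇒Pos-s : ∀ {d e} → Pos (support d e A) → NonNeg (- support d e B) →
                      NonNeg (- support d e C) → ¬ ¬ Pos s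
    separated⇒Pos-s {d} {e} pA nB nC ¬ps = nonorthogonal⇒nonzero ((- 1#) ⊙ d) z
      (Pos-resp (begin
        support d e A + support d e A + (- support d e B + - support d e C)
          ≈⟨ solve 4 (λ a b c e → (a :+ e) :+ (a :+ e) :+ (:- (b :+ e) :+ :- (c :+ e)) :=
               :- :1 :* (b :+ c :- (a :+ a))) refl (dot d A) (dot d B) (dot d C) e ⟩
        - 1# * (dot d B + dot d C - (dot d A + dot d A))
          ≈⟨ *-congˡ (sym (trans (dot-comm z d) (dot-midpoint d))) ⟩
        - 1# * dot z d         ≈⟨ sym (trans (dot-comm ((- 1#) ⊙ d) z) (dot-⊙ʳ (- 1#) z d)) ⟩
        dot ((- 1#) ⊙ d) z     ∎)
        (Pos+NonNeg (Pos-+ pA pA) (NonNeg-+ nB nC)))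
      λ p → [ ¬ps , ¬ps ]′ (Pos-split (Pos-resp midpoint-normSq p))

  separated⇒Pos-k : ∀ {t d e} {A B : Tuple t} → Unit A → Unit B →
    Pos (support d e A) → NonNeg (- support d e B) → ¬ ¬ Pos (1# - dot A B)
  separated⇒Pos-k {d = d} {e} {A} {B} unitA unitB pA nB ¬pk = nonorthogonal⇒nonzero d (A ⊖ B)
    (Pos-resp (begin
      support d e A + - support d e B
        ≈⟨ solve 3 (λ a b e → (a :+ e) :- (b :+ e) := a :- b) refl (dot d A) (dot d B) e ⟩
      dot d A - dot d B    ≈⟨ sym (dot-⊖ʳ d A B) ⟩
      dot d (A ⊖ B)        ∎) (Pos+NonNeg pA nB))
    λ p → [ ¬pk , ¬pk ]′ (Pos-split (Pos-resp (begin
      normSq (A ⊖ B)             ≈⟨ dot-⊖ʳ (A ⊖ B) A B ⟩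
      dot (A ⊖ B) A - dot (A ⊖ B) B
        ≈⟨ +-cong (trans (dot-comm (A ⊖ B) A) (dot-⊖ʳ A A B))
                  (-‿cong (trans (dot-comm (A ⊖ B) B) (dot-⊖ʳ B A B))) ⟩
      (normSq A - dot A B) - (dot B A - normSq B)
        ≈⟨ +-cong (+-congʳ unitA) (-‿cong (+-cong (dot-comm B A) (-‿cong unitB))) ⟩
      (1# - dot A B) - (dot A B - 1#)
        ≈⟨ solve 1 (λ k → (:1 :- k) :- (k :- :1) := (:1 :- k) :+ (:1 :- k)) refl (dot A B) ⟩
      (1# - dot A B) + (1# - dot A B) ∎) p))

  -- Reading `l i` and `h i` as the ends of successive intervals between `L` and `H`, the first is
  -- split off and its right end takes the place of `L`.
  telescope : ∀ m {L H} (l h : Vector Carrier (ℕ.suc m)) → NonNeg (l zero - L) →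
    (∀ i → NonNeg (l (suc i) - h (inject₁ i))) → NonNeg (H - h (fromℕ m)) →
    NonNeg ((H - L) - sum (λ i → h i - l i))
  telescope ℕ.zero {L} {H} l h first _ last = NonNeg-resp
    (begin
      (l zero - L) + (H - h zero)
        ≈⟨ solve 4 (λ l L H h → (l :- L) :+ (H :- h) := (H :- L) :- (h :- l)) refl _ _ _ _ ⟩
      (H - L) - (h zero - l zero)    ≈⟨ +-congˡ (-‿cong (sym (+-identityʳ _))) ⟩
      (H - L) - (h zero - l zero + 0#) ∎)
    (NonNeg-+ first last)
  telescope (ℕ.suc m) {L} {H} l h first step last = NonNeg-resp
    (solve 5 (λ l L H h S → (l :- L) :+ ((H :- h) :- S) := (H :- L) :- (h :- l :+ S)) refl
      (l zero) L H (h zero) _)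
    (NonNeg-+ first (telescope m (l ∘ suc) (h ∘ suc) (step zero) (step ∘ suc) last))

-- The ordered field of real numbers

module Reals where

  open ≡ using (refl; sym; trans; cong; cong₂; subst)
  open +-*-Solver

  Eventually : Pred ℕ 0ℓ → Set
  Eventually P = ∃[ N ] (∀ n → N ℕ.≤ n → P n)

  eventually-map : ∀ {P Q : Pred ℕ 0ℓ} → (∀ n → P n → Q n) → Eventually P → Eventually Q
  eventually-map f (N , p) = N , λ n N≤n → f n (p n N≤n)

  eventually-both : ∀ {P Q R : Pred ℕ 0ℓ} → (∀ n → P n → Q n → R n) →
                    Eventually P → Eventually Q → Eventually R
  eventually-both f (M , p) (N , q) = M ℕ.⊔ N , λ n ≤n →
    f n (p n (ℕP.m⊔n≤o⇒m≤o M N ≤n)) (q n (ℕP.m⊔n≤o⇒n≤o M N ≤n))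

  ∣p∣<ε⁺ : ∀ {p ε} → p ℚ.< ε → ℚ.- p ℚ.< ε → ∣ p ∣ ℚ.< ε
  ∣p∣<ε⁺ {p} {ε} p<ε -p<ε with ℚP.∣p∣≡p∨∣p∣≡-p p
  ... | inj₁ eq = subst (ℚ._< ε) (sym eq) p<ε
  ... | inj₂ eq = subst (ℚ._< ε) (sym eq) -p<ε

  p≤∣p∣ : ∀ p → p ℚ.≤ ∣ p ∣
  p≤∣p∣ p with ℚP.≤-total 0ℚ p
  ... | inj₁ 0≤p = ℚP.≤-reflexive (sym (ℚP.0≤p⇒∣p∣≡p 0≤p))
  ... | inj₂ p≤0 = ℚP.≤-trans p≤0 (ℚP.0≤∣p∣ p)

  ∣p-q∣≡∣q-p∣ : ∀ p q → ∣ p ℚ.- q ∣ ≡ ∣ q ℚ.- p ∣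
  ∣p-q∣≡∣q-p∣ p q = trans (sym (ℚP.∣-p∣≡∣p∣ (p ℚ.- q)))
    (cong ∣_∣ (solve 2 (λ p q → :- (p :- q) := q :- p) refl p q))

  ∣sum∣<ε : ∀ {p q ε} → ∣ p ∣ ℚ.< ½ ℚ.* ε → ∣ q ∣ ℚ.< ½ ℚ.* ε → ∣ p ℚ.+ q ∣ ℚ.< ε
  ∣sum∣<ε {p} {q} {ε} p< q< = subst (∣ p ℚ.+ q ∣ ℚ.<_) (half+half ε)
    (ℚP.≤-<-trans (ℚP.∣p+q∣≤∣p∣+∣q∣ p q) (ℚP.+-mono-< p< q<))

  eventually-≡⇒≈ : ∀ {x y} → Eventually (λ n → seq x n ≡ seq y n) → x ≈ℝ y
  eventually-≡⇒≈ {x} {y} eq ε 0<ε = eventually-map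
    (λ n eq → subst (λ q → ∣ q ∣ ℚ.< ε)
      (sym (trans (cong (ℚ._- seq y n) eq) (ℚP.+-inverseʳ (seq y n)))) 0<ε) eq

  pointwise : ∀ {x y} → (∀ n → seq x n ≡ seq y n) → x ≈ℝ y
  pointwise {x} {y} eq = eventually-≡⇒≈ {x} {y} (0 , λ n _ → eq n)

  ≈-sym : ∀ {x y} → x ≈ℝ y → y ≈ℝ x
  ≈-sym {x} {y} x≈y ε 0<ε = eventually-map
    (λ n → subst (ℚ._< ε) (∣p-q∣≡∣q-p∣ (seq x n) (seq y n))) (x≈y ε 0<ε)

  ≈-trans : ∀ {x y z} → x ≈ℝ y → y ≈ℝ z → x ≈ℝ z
  ≈-trans {x} {y} {z} x≈y y≈z ε 0<ε = eventually-both
    (λ n p q → subst (λ d → ∣ d ∣ ℚ.< ε)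
      (solve 3 (λ x y z → (x :- y) :+ (y :- z) := x :- z) refl (seq x n) (seq y n) (seq z n))
      (∣sum∣<ε {seq x n ℚ.- seq y n} p q))
    (x≈y _ (half-pos ε 0<ε)) (y≈z _ (half-pos ε 0<ε))

  +-cong : ∀ {x x′ y y′} → x ≈ℝ x′ → y ≈ℝ y′ → x +ℝ y ≈ℝ x′ +ℝ y′
  +-cong {x} {x′} {y} {y′} x≈ y≈ ε 0<ε = eventually-both
    (λ n p q → subst (λ d → ∣ d ∣ ℚ.< ε)
      (solve 4 (λ x x′ y y′ → (x :- x′) :+ (y :- y′) := (x :+ y) :- (x′ :+ y′)) refl
        (seq x n) (seq x′ n) (seq y n) (seq y′ n))
      (∣sum∣<ε {seq x n ℚ.- seq x′ n} p q))
    (x≈ _ (half-pos ε 0<ε)) (y≈ _ (half-pos ε 0<ε))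

  -‿cong : ∀ {x y} → x ≈ℝ y → -ℝ x ≈ℝ -ℝ y
  -‿cong {x} {y} x≈y ε 0<ε = eventually-map
    (λ n → subst (ℚ._< ε) (trans (∣p-q∣≡∣q-p∣ (seq x n) (seq y n)) (cong ∣_∣
      (solve 2 (λ x y → y :- x := :- x :- :- y) refl (seq x n) (seq y n))))) (x≈y ε 0<ε)

  *-comm : ∀ x y → x *ℝ y ≈ℝ y *ℝ x
  *-comm x y = pointwise {x *ℝ y} {y *ℝ x} λ n → ℚP.*-comm (seq x n) (seq y n)

  *-congˡ : ∀ x {y y′} → y ≈ℝ y′ → x *ℝ y ≈ℝ x *ℝ y′
  *-congˡ x {y} {y′} y≈ ε 0<ε =
    let B , N , 0<B , x<B = bounded (seq x) (cauchy x)
        δ , 0<δ , Bδ≡ε = divide B ε 0<B 0<ε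
    in eventually-both
    (λ n p q → subst (∣ seq x n ℚ.* seq y n ℚ.- seq x n ℚ.* seq y′ n ∣ ℚ.<_) Bδ≡ε
      (subst (λ d → ∣ d ∣ ℚ.< B ℚ.* δ)
        (solve 3 (λ x y y′ → x :* (y :- y′) := x :* y :- x :* y′) refl (seq x n) (seq y n) (seq y′ n))
        (∣p*q∣<B*δ (seq x n) (seq y n ℚ.- seq y′ n) B δ 0<B p q)))
    (N , x<B) (y≈ δ 0<δ)

  *-cong : ∀ {x x′ y y′} → x ≈ℝ x′ → y ≈ℝ y′ → x *ℝ y ≈ℝ x′ *ℝ y′
  *-cong {x} {x′} {y} {y′} x≈ y≈ =
    ≈-trans {x *ℝ y} {x *ℝ y′} {x′ *ℝ y′} (*-congˡ x {y} {y′} y≈)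
      (≈-trans {x *ℝ y′} {y′ *ℝ x} {x′ *ℝ y′} (*-comm x y′)
        (≈-trans {y′ *ℝ x} {y′ *ℝ x′} {x′ *ℝ y′} (*-congˡ y′ {x} {x′} x≈) (*-comm y′ x′)))

  -- The rational `δ` keeps the sequence away from zero, which makes the notion invariant under
  -- `_≈ℝ_`.
  Pos : Pred ℝ 0ℓ
  Pos x = ∃[ δ ] (0ℚ ℚ.< δ × Eventually (λ n → δ ℚ.< seq x n))

  shift-< : ∀ {η δ x y} → η ℚ.+ η ≡ δ → δ ℚ.≤ x → ∣ x ℚ.- y ∣ ℚ.< η → η ℚ.< y
  shift-< {η} {_} {x} {y} refl δ≤x close = ≡.subst₂ ℚ._<_
    (solve 1 (λ η → η :+ η :- η := η) refl η)
    (solve 2 (λ x y → x :- (x :- y) := y) refl x y)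
    (ℚP.+-mono-≤-< δ≤x (ℚP.neg-antimono-< (ℚP.≤-<-trans (p≤∣p∣ (x ℚ.- y)) close)))

  Pos-resp : ∀ {x y} → x ≈ℝ y → Pos x → Pos y
  Pos-resp {x} {y} x≈y (δ , 0<δ , δ<x) = ½ ℚ.* δ , half-pos δ 0<δ , eventually-both
    (λ n δ<x close → shift-< (half+half δ) (ℚP.<⇒≤ δ<x) close) δ<x (x≈y _ (half-pos δ 0<δ))

  Pos-1 : Pos 1ℝ
  Pos-1 = ½ , ℚP.positive⁻¹ ½ , 0 , λ _ _ → ℚP.+-monoʳ-< ½ (ℚP.positive⁻¹ ½)

  Pos-+ : ∀ {x y} → Pos x → Pos y → Pos (x +ℝ y)
  Pos-+ (δ , 0<δ , δ<x) (η , 0<η , η<y) = δ ℚ.+ η , ℚP.+-mono-< 0<δ 0<η ,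
    eventually-both (λ _ → ℚP.+-mono-<) δ<x η<y

  Pos-* : ∀ {x y} → Pos x → Pos y → Pos (x *ℝ y)
  Pos-* {x} {y} (δ , 0<δ , δ<x) (η , 0<η , η<y) = δ ℚ.* η ,
    subst (ℚ._< δ ℚ.* η) (ℚP.*-zeroʳ δ) (ℚP.*-monoʳ-<-pos δ {{ℚ.positive 0<δ}} 0<η) ,
    eventually-both (λ n δ<xₙ η<yₙ → ℚP.<-trans
      (ℚP.*-monoˡ-<-pos η {{ℚ.positive 0<η}} δ<xₙ)
      (ℚP.*-monoʳ-<-pos (seq x n) {{ℚ.positive (ℚP.<-trans 0<δ δ<xₙ)}} η<yₙ)) δ<x η<y

  -- One rational comparison decides: a term from which the sequence moves by less than a quarter of
  -- `ε` is compared with half of `ε`.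
  Pos-or-small : ∀ x ε → 0ℚ ℚ.< ε → Pos x ⊎ Eventually (λ n → seq x n ℚ.< ε)
  Pos-or-small x ε 0<ε =
    let N , close = cauchy x q 0<q in
    [ (λ ½ε≤ → inj₁ (q , 0<q , N , λ n N≤n →
        shift-< (half+half (½ ℚ.* ε)) ½ε≤ (close N n ℕP.≤-refl N≤n)))
    , (λ <½ε → inj₂ (N , λ n N≤n → ≡.subst₂ ℚ._<_
        (solve 2 (λ a b → a :- b :+ b := a) refl (seq x n) (seq x N)) (half+half ε)
        (ℚP.+-mono-<
          (ℚP.<-trans (ℚP.≤-<-trans (p≤∣p∣ (seq x n ℚ.- seq x N)) (close n N N≤n ℕP.≤-refl)) q<½ε)
          <½ε)))
    ]′ (½ε≤⊎<½ε (seq x N))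
    where
    q = ½ ℚ.* (½ ℚ.* ε)
    0<q = half-pos _ (half-pos ε 0<ε)
    q<½ε : q ℚ.< ½ ℚ.* ε
    q<½ε = ≡.subst₂ ℚ._<_ (ℚP.+-identityʳ q) (half+half (½ ℚ.* ε)) (ℚP.+-monoʳ-< q 0<q)
    ½ε≤⊎<½ε : ∀ p → ½ ℚ.* ε ℚ.≤ p ⊎ p ℚ.< ½ ℚ.* ε
    ½ε≤⊎<½ε p with p ℚP.<? ½ ℚ.* ε
    ... | yes p< = inj₂ p<
    ... | no  p≮ = inj₁ (ℚP.≮⇒≥ p≮)

  Pos-split : ∀ {x y} → Pos (x +ℝ y) → Pos x ⊎ Pos y
  Pos-split {x} {y} (δ , 0<δ , δ<x+y) = [ inj₁ , (λ small → inj₂ (½ ℚ.* δ , half-pos δ 0<δ ,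
    eventually-both
      (λ n δ< x< → ℚP.≰⇒> λ y≤ → ℚP.<-irrefl refl (ℚP.<-trans δ<
        (subst (seq x n ℚ.+ seq y n ℚ.<_) (half+half δ) (ℚP.+-mono-<-≤ x< y≤))))
      δ<x+y small)) ]′ (Pos-or-small x (½ ℚ.* δ) (half-pos δ 0<δ))

  eventually-absurd : ∀ {P : Pred ℕ 0ℓ} → Eventually P → (∀ n → ¬ P n) → ∀ {A : Set} → A
  eventually-absurd (N , p) ¬p = contradiction (p N ℕP.≤-refl) (¬p N)

  Pos-asym : ∀ {x} → Pos x → ¬ Pos (-ℝ x)
  Pos-asym {x} (δ , 0<δ , δ<x) (η , 0<η , η<-x) = eventually-absurd
    (eventually-both (λ n → ℚP.+-mono-<) δ<x η<-x)
    (λ n p → ℚP.<-asym (subst (δ ℚ.+ η ℚ.<_) (ℚP.+-inverseʳ (seq x n)) p) (ℚP.+-mono-< 0<δ 0<η))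

  ¬Pos⇒small : ∀ {x} → ¬ Pos x → ∀ ε → 0ℚ ℚ.< ε → Eventually (λ n → seq x n ℚ.< ε)
  ¬Pos⇒small {x} ¬px ε 0<ε =
    [ (λ px → contradiction px ¬px) , (λ small → small) ]′ (Pos-or-small x ε 0<ε)

  tight : ∀ {x} → ¬ Pos x → ¬ Pos (-ℝ x) → x ≈ℝ 0ℝ
  tight {x} ¬px ¬p-x ε 0<ε = eventually-both
    (λ n x<ε -x<ε → subst (λ q → ∣ q ∣ ℚ.< ε) (sym (ℚP.+-identityʳ (seq x n))) (∣p∣<ε⁺ x<ε -x<ε))
    (¬Pos⇒small {x} ¬px ε 0<ε) (¬Pos⇒small { -ℝ x} ¬p-x ε 0<ε)

  -- Truncating the sequence below at `δ` makes every term invertible and changes only finitely many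
  -- terms; the reciprocals are then bounded.
  inverse : ∀ {x} → Pos x → ∃[ y ] x *ℝ y ≈ℝ 1ℝ
  inverse {x} (δ , 0<δ , N , δ<x) = mkℝ r r-cauchy ,
    eventually-≡⇒≈ {x *ℝ mkℝ r r-cauchy} {1ℝ} (N , λ n N≤n →
      trans (cong (ℚ._* r n) (sym (truncated n N≤n))) (xr n))
    where
    open ℚP.≤-Reasoning
    x′ : ℕ → ℚ
    x′ n = seq x n ℚ.⊔ δ
    δ≤x′ : ∀ n → δ ℚ.≤ x′ n
    δ≤x′ n = ℚP.p≤q⊔p (seq x n) δ
    0<x′ : ∀ n → 0ℚ ℚ.< x′ n
    0<x′ n = ℚP.<-≤-trans 0<δ (δ≤x′ n)
    truncated : ∀ n → N ℕ.≤ n → x′ n ≡ seq x n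
    truncated n N≤n = ℚP.p≥q⇒p⊔q≡p (ℚP.<⇒≤ (δ<x n N≤n))
    r : ℕ → ℚ
    r n = proj₁ (divide (x′ n) 1ℚ (0<x′ n) (ℚP.positive⁻¹ 1ℚ))
    0<r : ∀ n → 0ℚ ℚ.< r n
    0<r n = proj₁ (proj₂ (divide (x′ n) 1ℚ (0<x′ n) (ℚP.positive⁻¹ 1ℚ)))
    xr : ∀ n → x′ n ℚ.* r n ≡ 1ℚ
    xr n = proj₂ (proj₂ (divide (x′ n) 1ℚ (0<x′ n) (ℚP.positive⁻¹ 1ℚ)))
    δ⁻¹ B : ℚ
    δ⁻¹ = proj₁ (divide δ 1ℚ 0<δ (ℚP.positive⁻¹ 1ℚ))
    -- The reciprocals are at most `δ⁻¹`; adding one makes the bound strict.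
    B = δ⁻¹ ℚ.+ 1ℚ
    0<B : 0ℚ ℚ.< B
    0<B = ℚP.+-mono-< (proj₁ (proj₂ (divide δ 1ℚ 0<δ (ℚP.positive⁻¹ 1ℚ)))) (ℚP.positive⁻¹ 1ℚ)
    r<B : ∀ n → r n ℚ.< B
    r<B n = ℚP.≰⇒> λ B≤r → ℚP.<-irrefl refl (begin-strict
      1ℚ              ≡⟨ sym (proj₂ (proj₂ (divide δ 1ℚ 0<δ (ℚP.positive⁻¹ 1ℚ)))) ⟩
      δ ℚ.* δ⁻¹         ≡⟨ sym (ℚP.+-identityʳ (δ ℚ.* δ⁻¹)) ⟩
      δ ℚ.* δ⁻¹ ℚ.+ 0ℚ  <⟨ ℚP.+-monoʳ-< (δ ℚ.* δ⁻¹) 0<δ ⟩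
      δ ℚ.* δ⁻¹ ℚ.+ δ   ≡⟨ solve 2 (λ d b → d :* b :+ d := d :* (b :+ con 1ℚ)) refl δ δ⁻¹ ⟩
      δ ℚ.* B         ≤⟨ ℚP.*-monoˡ-≤-nonNeg δ {{ℚ.nonNegative (ℚP.<⇒≤ 0<δ)}} B≤r ⟩
      δ ℚ.* r n       ≤⟨ ℚP.*-monoʳ-≤-nonNeg (r n) {{ℚ.nonNegative (ℚP.<⇒≤ (0<r n))}} (δ≤x′ n) ⟩
      x′ n ℚ.* r n    ≡⟨ xr n ⟩
      1ℚ              ∎)
    ∣r∣<B : ∀ n → ∣ r n ∣ ℚ.< B
    ∣r∣<B n = subst (ℚ._< B) (sym (ℚP.0≤p⇒∣p∣≡p (ℚP.<⇒≤ (0<r n)))) (r<B n)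
    r-cauchy : IsCauchy r
    r-cauchy ε 0<ε =
      -- Late differences `r m - r n` equal `r m * (r n * (x n - x m))`, and each factor `r` costs
      -- one division by `B`.
      let η , 0<η , Bη = divide B ε 0<B 0<ε
          θ , 0<θ , Bθ = divide B η 0<B 0<η
          M , close = cauchy x θ 0<θ
      in N ℕ.⊔ M , λ m n ≤m ≤n → begin-strict
      ∣ r m ℚ.- r n ∣
        ≡⟨ cong ∣_∣ (cong₂ ℚ._-_ (sym (ℚP.*-identityʳ (r m))) (sym (ℚP.*-identityʳ (r n)))) ⟩
      ∣ r m ℚ.* 1ℚ ℚ.- r n ℚ.* 1ℚ ∣
        ≡⟨ cong₂ (λ p q → ∣ r m ℚ.* p ℚ.- r n ℚ.* q ∣)
             (sym (trans (cong (ℚ._* r n) (sym (truncated n (ℕP.m⊔n≤o⇒m≤o N M ≤n)))) (xr n)))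
             (sym (trans (cong (ℚ._* r m) (sym (truncated m (ℕP.m⊔n≤o⇒m≤o N M ≤m)))) (xr m))) ⟩
      ∣ r m ℚ.* (seq x n ℚ.* r n) ℚ.- r n ℚ.* (seq x m ℚ.* r m) ∣
        ≡⟨ cong ∣_∣ (solve 4 (λ p q a b → p :* (b :* q) :- q :* (a :* p) := p :* (q :* (b :- a)))
             refl (r m) (r n) (seq x m) (seq x n)) ⟩
      ∣ r m ℚ.* (r n ℚ.* (seq x n ℚ.- seq x m)) ∣
        <⟨ ∣p*q∣<B*δ (r m) _ B η 0<B (∣r∣<B m)
             (subst (∣ r n ℚ.* (seq x n ℚ.- seq x m) ∣ ℚ.<_) Bθ
               (∣p*q∣<B*δ (r n) _ B θ 0<B (∣r∣<B n)
                 (close n m (ℕP.m⊔n≤o⇒n≤o N M ≤n) (ℕP.m⊔n≤o⇒n≤o N M ≤m)))) ⟩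
      B ℚ.* η ≡⟨ Bη ⟩
      ε ∎

  -- Opaque, since unfolded sums of reals carry their Cauchy proofs along.
  opaque
    add mul : ℝ → ℝ → ℝ
    add = _+ℝ_
    mul = _*ℝ_

    neg : ℝ → ℝ
    neg = -ℝ_

    seq-add : ∀ x y n → seq (add x y) n ≡ seq x n ℚ.+ seq y n
    seq-add _ _ _ = refl

    seq-mul : ∀ x y n → seq (mul x y) n ≡ seq x n ℚ.* seq y n
    seq-mul _ _ _ = refl

    seq-neg : ∀ x n → seq (neg x) n ≡ ℚ.- seq x n
    seq-neg _ _ = refl

    isCommutativeRing : IsCommutativeRing _≈ℝ_ add mul neg 0ℝ 1ℝ
    isCommutativeRing = record
      { isRing = record
        { +-isAbelianGroup = record
          { isGroup = record
            { isMonoid = record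
              { isSemigroup = record
                { isMagma = record
                  { isEquivalence = record
                    { refl  = λ {x} → pointwise {x} {x} λ _ → refl
                    ; sym   = λ {x} {y} → ≈-sym {x} {y}
                    ; trans = λ {x} {y} {z} → ≈-trans {x} {y} {z}
                    }
                  ; ∙-cong = λ {x} {x′} {y} {y′} → +-cong {x} {x′} {y} {y′}
                  }
                ; assoc = λ x y z → pointwise {x +ℝ y +ℝ z} {x +ℝ (y +ℝ z)} λ n →
                    ℚP.+-assoc (seq x n) (seq y n) (seq z n)
                }
              ; identity = (λ x → pointwise {0ℝ +ℝ x} {x} λ n → ℚP.+-identityˡ (seq x n))
                         , (λ x → pointwise {x +ℝ 0ℝ} {x} λ n → ℚP.+-identityʳ (seq x n))
              }
            ; inverse = (λ x → pointwise { -ℝ x +ℝ x} {0ℝ} λ n → ℚP.+-inverseˡ (seq x n))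
                      , (λ x → pointwise {x -ℝ x} {0ℝ} λ n → ℚP.+-inverseʳ (seq x n))
            ; ⁻¹-cong = λ {x} {y} → -‿cong {x} {y}
            }
          ; comm = λ x y → pointwise {x +ℝ y} {y +ℝ x} λ n → ℚP.+-comm (seq x n) (seq y n)
          }
        ; *-cong = λ {x} {x′} {y} {y′} → *-cong {x} {x′} {y} {y′}
        ; *-assoc = λ x y z → pointwise {x *ℝ y *ℝ z} {x *ℝ (y *ℝ z)} λ n →
            ℚP.*-assoc (seq x n) (seq y n) (seq z n)
        ; *-identity = (λ x → pointwise {1ℝ *ℝ x} {x} λ n → ℚP.*-identityˡ (seq x n))
                     , (λ x → pointwise {x *ℝ 1ℝ} {x} λ n → ℚP.*-identityʳ (seq x n))
        ; distrib = (λ x y z → pointwise {x *ℝ (y +ℝ z)} {x *ℝ y +ℝ x *ℝ z} λ n →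
                      ℚP.*-distribˡ-+ (seq x n) (seq y n) (seq z n))
                  , (λ x y z → pointwise {(y +ℝ z) *ℝ x} {y *ℝ x +ℝ z *ℝ x} λ n →
                      ℚP.*-distribʳ-+ (seq x n) (seq y n) (seq z n))
        }
      ; *-comm = *-comm
      }

    add-Pos : ∀ {x y} → Pos x → Pos y → Pos (add x y)
    add-Pos {x} {y} = Pos-+ {x} {y}

    mul-Pos : ∀ {x y} → Pos x → Pos y → Pos (mul x y)
    mul-Pos {x} {y} = Pos-* {x} {y}

    split-Pos : ∀ {x y} → Pos (add x y) → Pos x ⊎ Pos y
    split-Pos {x} {y} = Pos-split {x} {y}

    asym-Pos : ∀ {x} → Pos x → ¬ Pos (neg x)
    asym-Pos {x} = Pos-asym {x}

    tight-Pos : ∀ {x} → ¬ Pos x → ¬ Pos (neg x) → x ≈ℝ 0ℝ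
    tight-Pos {x} = tight {x}

    inverse-Pos : ∀ {x} → Pos x → ∃[ y ] mul x y ≈ℝ 1ℝ
    inverse-Pos {x} = inverse {x}

  field-ℝ : StablyOrderedField
  field-ℝ = record
    { commutativeRing = record { isCommutativeRing = isCommutativeRing }
    ; rationals = record
      { ⟦_⟧    = fromℚ
      ; +-homo = λ p q → pointwise {fromℚ (p ℚ.+ q)} {add (fromℚ p) (fromℚ q)} λ n →
          sym (seq-add (fromℚ p) (fromℚ q) n)
      ; *-homo = λ p q → pointwise {fromℚ (p ℚ.* q)} {mul (fromℚ p) (fromℚ q)} λ n →
          sym (seq-mul (fromℚ p) (fromℚ q) n)
      ; -‿homo = λ p → pointwise {fromℚ (ℚ.- p)} {neg (fromℚ p)} λ n → sym (seq-neg (fromℚ p) n)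
      ; 0-homo = pointwise {0ℝ} {0ℝ} λ _ → refl
      ; 1-homo = pointwise {1ℝ} {1ℝ} λ _ → refl
      }
    ; Pos       = Pos
    ; Pos-resp  = λ {x} {y} → Pos-resp {x} {y}
    ; Pos-1     = Pos-1
    ; Pos-+     = λ {x} {y} → add-Pos {x} {y}
    ; Pos-*     = λ {x} {y} → mul-Pos {x} {y}
    ; Pos-split = λ {x} {y} → split-Pos {x} {y}
    ; Pos-asym  = λ {x} → asym-Pos {x}
    ; tight     = λ {x} → tight-Pos {x}
    ; inverse   = λ {x} → inverse-Pos {x}
    }

  open StablyOrderedField field-ℝ using (NonNeg; _-_)

  -- `z` stands for `y - x` and is specified by its sequence, because opaque subtraction does not
  -- reduce to the rational one.
  ≤⇒NonNeg : ∀ {x y} z → (∀ n → seq z n ≡ seq y n ℚ.- seq x n) → x ≤ℝ y → NonNeg z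
  ≤⇒NonNeg {x} {y} z z≡ x≤y (δ , 0<δ , δ<-z) = eventually-absurd
    (eventually-both {R = λ n → seq y n ℚ.+ δ ℚ.< seq y n ℚ.+ δ} (λ n δ< x< →
      ℚP.<-trans (ℚP.+-monoʳ-< (seq y n) (subst (δ ℚ.<_) (trans (seq-neg z n) (cong ℚ.-_ (z≡ n))) δ<))
      (subst (ℚ._< seq y n ℚ.+ δ)
        (solve 2 (λ x y → x := y :+ :- (y :- x)) refl (seq x n) (seq y n)) x<)) δ<-z (x≤y δ 0<δ))
    (λ n → ℚP.<-irrefl refl)

  NonNeg⇒≤ : ∀ {x y} z → (∀ n → seq z n ≡ seq y n ℚ.- seq x n) → NonNeg z → x ≤ℝ y
  NonNeg⇒≤ {x} {y} z z≡ nn ε 0<ε = eventually-map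
    (λ n lt → subst (ℚ._< seq y n ℚ.+ ε)
      (trans (cong (λ s → seq y n ℚ.+ s) (trans (seq-neg z n) (cong ℚ.-_ (z≡ n))))
        (solve 2 (λ x y → y :+ :- (y :- x) := x) refl (seq x n) (seq y n)))
      (ℚP.+-monoʳ-< (seq y n) lt))
    (¬Pos⇒small {neg z} nn ε 0<ε)

-- The thirty-three point geometry

-- Each block τ consists of its pivot (index 0) and five pairs low τ i < high τ i.
-- The order σ lists the low points of block σ, its pivot, the pairs of block
-- σ + 1, the pairs of block σ + 2, the high points of block σ, and finally the
-- other two pivots.
pivot : Fin 3 → Fin 33
pivot τ = combine {3} {11} τ (# 0)

low high : Fin 3 → Fin 5 → Fin 33
low  τ i = combine {3} {11} τ (suc (lookup (# 0 ∷ # 2 ∷ # 4 ∷ # 6 ∷ # 8 ∷ []) i))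
high τ i = combine {3} {11} τ (suc (lookup (# 1 ∷ # 3 ∷ # 5 ∷ # 7 ∷ # 9 ∷ []) i))

cyclicDifference : Fin 3 → Fin 3 → Fin 3
cyclicDifference σ τ = lookup (lookup
  ( (# 0 ∷ # 1 ∷ # 2 ∷ [])
  ∷ (# 2 ∷ # 0 ∷ # 1 ∷ [])
  ∷ (# 1 ∷ # 2 ∷ # 0 ∷ []) ∷ []) σ) τ

-- Row `δ` holds the positions of block `σ + δ` in the order `σ`: first the pivot, then low and high
-- points alternately.
positions : Vec (Vec ℕ 11) 3
positions =
    ( 5 ∷  0 ∷ 26 ∷  1 ∷ 27 ∷  2 ∷ 28 ∷  3 ∷ 29 ∷  4 ∷ 30 ∷ [])
  ∷ (31 ∷  6 ∷  7 ∷  8 ∷  9 ∷ 10 ∷ 11 ∷ 12 ∷ 13 ∷ 14 ∷ 15 ∷ [])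
  ∷ (32 ∷ 16 ∷ 17 ∷ 18 ∷ 19 ∷ 20 ∷ 21 ∷ 22 ∷ 23 ∷ 24 ∷ 25 ∷ []) ∷ []

rank : Fin 3 → Fin 33 → ℕ
rank σ x = lookup (lookup positions (cyclicDifference σ (proj₁ (remQuot {3} 11 x))))
                  (proj₂ (remQuot {3} 11 x))

next : Fin 3 → Fin 3
next σ = lookup (# 1 ∷ # 2 ∷ # 0 ∷ []) σ

-- The immediate successor of `pivot σ` in the order `σ`: position 6 after position 5.
bottom : Fin 3 → Fin 33
bottom σ = low (next σ) (# 0)

rank-injective : ∀ σ → Injective _≡_ _≡_ (rank σ)
rank-injective σ {x} {y} = injective σ x y
  where
  injective = toWitness {a? = FinP.all? λ σ → FinP.all? λ x → FinP.all? λ y →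
    (rank σ x ℕP.≟ rank σ y) →-dec (x FinP.≟ y)} tt

open OrderGeometry rank rank-injective

pivot<bottom : ∀ σ → rank σ (pivot σ) < rank σ (bottom σ)
pivot<bottom = toWitness {a? = FinP.all? λ σ → rank σ (pivot σ) ℕP.<? rank σ (bottom σ)} tt

-- In all orders but `σ`, `pivot σ` dominates such a point. Whether it is in the hull of `y` and
-- `pivot σ` can then be settled by comparing it with `y` in the order `σ` alone.
Ordinary : Fin 33 → Set
Ordinary x = ∀ σ ρ → ρ ≢ σ → rank ρ x ≤ rank ρ (pivot σ)

ordinary? : ∀ x → Dec (Ordinary x)
ordinary? x = FinP.all? λ σ → FinP.all? λ ρ →
  ¬? (ρ FinP.≟ σ) →-dec (rank ρ x ℕP.≤? rank ρ (pivot σ))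

low-ordinary : ∀ τ i → Ordinary (low τ i)
low-ordinary = toWitness {a? = FinP.all? λ τ → FinP.all? λ i → ordinary? (low τ i)} tt

high-ordinary : ∀ τ i → Ordinary (high τ i)
high-ordinary = toWitness {a? = FinP.all? λ τ → FinP.all? λ i → ordinary? (high τ i)} tt

low≤pivot : ∀ σ i ρ → rank ρ (low σ i) ≤ rank ρ (pivot σ)
low≤pivot = toWitness {a? = FinP.all? λ σ → FinP.all? λ i → FinP.all? λ ρ →
  rank ρ (low σ i) ℕP.≤? rank ρ (pivot σ)} tt

low≤high : ∀ σ i ρ → rank ρ (low σ i) ≤ rank ρ (high σ i)
low≤high = toWitness {a? = FinP.all? λ σ → FinP.all? λ i → FinP.all? λ ρ →
  rank ρ (low σ i) ℕP.≤? rank ρ (high σ i)} tt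

bottom≤high : ∀ σ i → rank σ (bottom σ) ≤ rank σ (high σ i)
bottom≤high = toWitness {a? = FinP.all? λ σ → FinP.all? λ i →
  rank σ (bottom σ) ℕP.≤? rank σ (high σ i)} tt

high-least : ∀ σ i → rank σ (high σ (# 0)) ≤ rank σ (high σ i)
high-least = toWitness {a? = FinP.all? λ σ → FinP.all? λ i →
  rank σ (high σ (# 0)) ℕP.≤? rank σ (high σ i)} tt

bottom≤low : ∀ σ ρ → σ ≢ ρ → ∀ i → rank ρ (bottom ρ) ≤ rank ρ (low σ i)
bottom≤low = toWitness {a? = FinP.all? λ σ → FinP.all? λ ρ → ¬? (σ FinP.≟ ρ) →-dec FinP.all? λ i →
  rank ρ (bottom ρ) ℕP.≤? rank ρ (low σ i)} tt

high≤low : ∀ σ ρ → σ ≢ ρ → ∀ (i : Fin 4) →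
           rank ρ (high σ (inject₁ i)) ≤ rank ρ (low σ (suc i))
high≤low = toWitness {a? = FinP.all? λ σ → FinP.all? λ ρ → ¬? (σ FinP.≟ ρ) →-dec FinP.all? λ i →
  rank ρ (high σ (inject₁ i)) ℕP.≤? rank ρ (low σ (suc i))} tt

high≤high : ∀ σ ρ → σ ≢ ρ → rank ρ (high σ (# 4)) ≤ rank ρ (high ρ (# 0))
high≤high = toWitness {a? = FinP.all? λ σ → FinP.all? λ ρ → ¬? (σ FinP.≟ ρ) →-dec
  (rank ρ (high σ (# 4)) ℕP.≤? rank ρ (high ρ (# 0)))} tt

bottom≤pivot : ∀ σ ρ → σ ≢ ρ → ∀ τ → rank ρ (bottom τ) ≤ rank ρ (pivot σ)
bottom≤pivot = toWitness {a? = FinP.all? λ σ → FinP.all? λ ρ →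
  ¬? (σ FinP.≟ ρ) →-dec FinP.all? λ τ →
  rank ρ (bottom τ) ℕP.≤? rank ρ (pivot σ)} tt

-- The convex dimension

pivot-injective : Injective _≡_ _≡_ pivot
pivot-injective {σ} {τ} = toWitness {a? = FinP.all? λ σ → FinP.all? λ τ →
  (pivot σ FinP.≟ pivot τ) →-dec (σ FinP.≟ τ)} tt σ τ

-- Block `τ` is at cyclic difference 2 from `next τ`, and the pivot in that row has the last
-- position, 32.
pivot-top : ∀ τ x → x ≢ pivot τ → rank (next τ) x < rank (next τ) (pivot τ)
pivot-top = toWitness {a? = FinP.all? λ τ → FinP.all? λ x → ¬? (x FinP.≟ pivot τ) →-dec
  (rank (next τ) x ℕP.<? rank (next τ) (pivot τ))} tt

pivot-extreme : ∀ τ → hull (∁ ⁅ pivot τ ⁆) ≡ ∁ ⁅ pivot τ ⁆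
pivot-extreme τ = ⊆-antisym
  (λ {x} x∈ → x∉p⇒x∈∁p λ x∈d →
    let y , y∈ , x≤y = ∈-hull⁻ x∈ (next τ)
        y≢d = λ y≡d → x∈∁p⇒x∉p y∈ (≡.subst (_∈ ⁅ pivot τ ⁆) (≡.sym y≡d) (x∈⁅x⁆ (pivot τ)))
    in ℕP.<⇒≱ (pivot-top τ y y≢d)
         (≡.subst (λ x → rank (next τ) x ≤ rank (next τ) y) (x∈⁅y⁆⇒x≡y (pivot τ) x∈d) x≤y))
  (hull-extensive _)

convexDimension-3 : HasConvexDimension geometry 3
convexDimension-3 = Join.isJoinOfMonotone rank rank-injective ,
  λ j → extreme-points≤join-size geometry pivot pivot-injective pivot-extreme

-- The contradiction from three separating directions

module Obstruction (F : StablyOrderedField) where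
  open StablyOrderedField F
  open Geometry F

  module _ {t} (c : Fin 33 → Tuple t) (r : Fin 33 → Carrier)
    (hullBound : ∀ x y z → (∀ σ → rank σ x ≤ rank σ y ⊎ rank σ x ≤ rank σ z) → ∀ u → Unit u → ∀ M →
                 NonNeg (M - support (c y) (r y) u) → NonNeg (M - support (c z) (r z) u) →
                 NonNeg (M - support (c x) (r x) u))
    (U : Fin 3 → Tuple t) (unit : ∀ σ → Unit (U σ))
    (strict : ∀ σ → Pos (support (c (bottom σ)) (r (bottom σ)) (U σ) -
                         support (c (pivot σ)) (r (pivot σ)) (U σ)))
    where

    f : Fin 33 → Tuple t → Carrier
    f x = support (c x) (r x)

    NonNeg-diff : ∀ {x} → NonNeg (x - x)
    NonNeg-diff {x} = NonNeg-resp (sym (-‿inverseʳ x)) NonNeg-0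

    dominated≤ : ∀ x y → (∀ ρ → rank ρ x ≤ rank ρ y) → ∀ u → Unit u → NonNeg (f y u - f x u)
    dominated≤ x y x≤y u unit = hullBound x y y (inj₁ ∘ x≤y) u unit (f y u) NonNeg-diff NonNeg-diff

    bounded-by : ∀ σ x y → Ordinary x → rank σ x ≤ rank σ y → ∀ M →
      NonNeg (M - f y (U σ)) → NonNeg (M - f (pivot σ) (U σ)) → NonNeg (M - f x (U σ))
    bounded-by σ x y ordinary x≤y = hullBound x y (pivot σ) below (U σ) (unit σ)
      where
      below : ∀ ρ → rank ρ x ≤ rank ρ y ⊎ rank ρ x ≤ rank ρ (pivot σ)
      below ρ with ρ FinP.≟ σ
      ... | yes ≡.refl = inj₁ x≤y
      ... | no  ρ≢σ    = inj₂ (ordinary σ ρ ρ≢σ)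

    bottom-ordinary : ∀ σ → Ordinary (bottom σ)
    bottom-ordinary σ = low-ordinary (next σ) (# 0)

    -- If `y` fell below the pivot at `U σ`, the pivot's value would bound both, hence also
    -- `bottom σ`, which lies in the hull of the two. This contradicts `strict`.
    pivot≤ : ∀ σ y → rank σ (bottom σ) ≤ rank σ y → NonNeg (f y (U σ) - f (pivot σ) (U σ))
    pivot≤ σ y b≤y p = contradict (strict σ)
      (bounded-by σ (bottom σ) y (bottom-ordinary σ) b≤y (f (pivot σ) (U σ)) (NonNeg-resp
        (solve 2 (λ a b → :- (a :- b) := b :- a) refl _ _) (Pos⇒NonNeg p)) NonNeg-diff)
      (trans (solve 2 (λ a b → (a :- b) :+ (b :- a) := con ℚ.0ℚ) refl _ _) rational-zero)

    -- By `pivot≤` the value of `y` bounds that of the pivot, so it bounds everything in the hull of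
    -- the two.
    sorted : ∀ σ x y → Ordinary x → rank σ x ≤ rank σ y → rank σ (bottom σ) ≤ rank σ y →
             NonNeg (f y (U σ) - f x (U σ))
    sorted σ x y ordinary x≤y b≤y =
      bounded-by σ x y ordinary x≤y (f y (U σ)) NonNeg-diff (pivot≤ σ y b≤y)

    difference : ∀ x y u → support (c y ⊖ c x) (r y - r x) u ≈ f y u - f x u
    difference x y u = support-⊖ (c x) (c y) (r x) (r y) u

    bottom-strict : ∀ σ →
      Pos (support (c (bottom σ) ⊖ c (pivot σ)) (r (bottom σ) - r (pivot σ)) (U σ))
    bottom-strict σ = Pos-resp (sym (difference (pivot σ) (bottom σ) (U σ))) (strict σ)

    bottom≤pivot-elsewhere : ∀ σ ρ → σ ≢ ρ →
      NonNeg (- support (c (bottom σ) ⊖ c (pivot σ)) (r (bottom σ) - r (pivot σ)) (U ρ))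
    bottom≤pivot-elsewhere σ ρ σ≢ρ = NonNeg-resp
      (trans (solve 2 (λ a b → a :- b := :- (b :- a)) refl _ _)
             (-‿cong (sym (difference (pivot σ) (bottom σ) (U ρ)))))
      (sorted ρ (bottom σ) (pivot σ) (bottom-ordinary σ)
        (bottom≤pivot σ ρ σ≢ρ σ) (bottom≤pivot σ ρ σ≢ρ ρ))

    -- Half the squared distance of two directions.
    chord : Fin 3 → Fin 3 → Carrier
    chord σ ρ = 1# - dot (U σ) (U ρ)

    chord-pos : ∀ σ ρ → σ ≢ ρ → ¬ ¬ Pos (chord σ ρ)
    chord-pos σ ρ σ≢ρ = separated⇒Pos-k {d = c (bottom σ) ⊖ c (pivot σ)} {A = U σ} {U ρ}
      (unit σ) (unit ρ) (bottom-strict σ) (bottom≤pivot-elsewhere σ ρ σ≢ρ)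

    chord-nonneg : ∀ σ ρ → σ ≢ ρ → NonNeg (chord σ ρ)
    chord-nonneg σ ρ σ≢ρ p = chord-pos σ ρ σ≢ρ λ q → Pos-asym q p

    -- The unweighted range at `U σ`, from the pivot to the lowest high point of block `σ`.
    core : Fin 3 → Carrier
    core σ = f (high σ (# 0)) (U σ) - f (pivot σ) (U σ)

    core-pos : ∀ σ → Pos (core σ)
    core-pos σ = Pos-resp
      (solve 3 (λ o d h → (o :- d) :+ (h :- o) := h :- d) refl _ _ _)
      (Pos+NonNeg (strict σ) (sorted σ (bottom σ) (high σ (# 0)) (bottom-ordinary σ)
        (bottom≤high σ (# 0)) (bottom≤high σ (# 0))))

    gap : Fin 3 → Fin 3 → Fin 5 → Carrier
    gap σ ρ i = f (high σ i) (U ρ) - f (low σ i) (U ρ)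

    five : Carrier → Carrier
    five x = x + x + x + x + x

    -- Low points are dominated by the pivot in all orders, and high points lie above the first of
    -- them at `U σ`, so each pair spans the range.
    sum-gap-own : ∀ σ → NonNeg (sum (gap σ σ) - five (core σ))
    sum-gap-own σ = NonNeg-resp
      (solve 7 (λ a b c d e I z →
        (a :- I) :+ ((b :- I) :+ ((c :- I) :+ ((d :- I) :+ ((e :- I) :+ z)))) :=
        (a :+ (b :+ (c :+ (d :+ (e :+ z))))) :- (I :+ I :+ I :+ I :+ I)) refl
        (gap σ σ (# 0)) (gap σ σ (# 1)) (gap σ σ (# 2)) (gap σ σ (# 3)) (gap σ σ (# 4)) (core σ) 0#)
      (NonNeg-sum _ λ i → NonNeg-resp
        (solve 4 (λ h₀ d h l → (h :- h₀) :+ (d :- l) := (h :- l) :- (h₀ :- d)) refl _ _ _ _)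
        (NonNeg-+ (sorted σ (high σ (# 0)) (high σ i) (high-ordinary σ (# 0))
                    (high-least σ i) (bottom≤high σ i))
                  (dominated≤ (low σ i) (pivot σ) (low≤pivot σ i) (U σ) (unit σ))))

    -- The values at `U ρ` follow the order `ρ` above its pivot, where the pairs of block `σ` come
    -- one after another below the high points of block `ρ`.
    sum-gap-other : ∀ σ ρ → σ ≢ ρ → NonNeg (core ρ - sum (gap σ ρ))
    sum-gap-other σ ρ σ≢ρ = telescope 4 (λ i → f (low σ i) (U ρ)) (λ i → f (high σ i) (U ρ))
      (pivot≤ ρ (low σ (# 0)) (bottom≤low σ ρ σ≢ρ (# 0)))
      (λ i → sorted ρ (high σ (inject₁ i)) (low σ (suc i)) (high-ordinary σ (inject₁ i))
        (high≤low σ ρ σ≢ρ i) (bottom≤low σ ρ σ≢ρ (suc i)))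
      (sorted ρ (high σ (# 4)) (high ρ (# 0)) (high-ordinary σ (# 4))
        (high≤high σ ρ σ≢ρ) (bottom≤high ρ (# 0)))

    sum-combination : ∀ {m} k₁ k₂ k₃ (α β γ : Vector Carrier m) →
      sum (λ i → ((k₂ * β i + k₃ * γ i) + (k₂ * β i + k₃ * γ i)) - k₁ * α i) ≈
      ((k₂ * sum β + k₃ * sum γ) + (k₂ * sum β + k₃ * sum γ)) - k₁ * sum α
    sum-combination {ℕ.zero} k₁ k₂ k₃ α β γ = sym (trans
      (solve 4 (λ a b c z → ((b :* z :+ c :* z) :+ (b :* z :+ c :* z)) :- a :* z :=
        (b :+ c :+ (b :+ c) :- a) :* z) refl k₁ k₂ k₃ 0#) (zeroʳ _))
    sum-combination {ℕ.suc m} k₁ k₂ k₃ α β γ = trans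
      (+-congˡ (sum-combination k₁ k₂ k₃ (α ∘ suc) (β ∘ suc) (γ ∘ suc)))
      (solve 9 (λ k₁ k₂ k₃ a b c A B C →
        (((k₂ :* b :+ k₃ :* c) :+ (k₂ :* b :+ k₃ :* c)) :- k₁ :* a) :+
        (((k₂ :* B :+ k₃ :* C) :+ (k₂ :* B :+ k₃ :* C)) :- k₁ :* A) :=
        ((k₂ :* (b :+ B) :+ k₃ :* (c :+ C)) :+ (k₂ :* (b :+ B) :+ k₃ :* (c :+ C))) :- k₁ :* (a :+ A))
        refl k₁ k₂ k₃ (α zero) (β zero) (γ zero) (sum (α ∘ suc)) (sum (β ∘ suc)) (sum (γ ∘ suc)))

    -- The sum of `casey` over the five pairs of block `σ`, with the gaps at `U σ` bounded below and
    -- the gaps at the other two directions bounded above by ranges.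
    core-inequality : ∀ σ ρ τ → σ ≢ ρ → σ ≢ τ → ρ ≢ τ →
      NonNeg (((chord τ σ * core ρ + chord σ ρ * core τ) +
               (chord τ σ * core ρ + chord σ ρ * core τ)) - chord ρ τ * five (core σ))
    core-inequality σ ρ τ σ≢ρ σ≢τ ρ≢τ p =
      separated⇒Pos-s {A = U σ} {U ρ} {U τ} (unit σ) (unit ρ) (unit τ)
        {c (bottom σ) ⊖ c (pivot σ)} (bottom-strict σ)
        (bottom≤pivot-elsewhere σ ρ σ≢ρ) (bottom≤pivot-elsewhere σ τ σ≢τ) λ ps →
      NonNeg-resp
        (solve 9 (λ a b c A B C I J K →
          ((b :* B :+ c :* C) :+ (b :* B :+ c :* C) :- a :* A) :+
            (a :* (A :- I) :+ ((b :* (J :- B) :+ c :* (K :- C)) :+ (b :* (J :- B) :+ c :* (K :- C)))) :=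
          (b :* J :+ c :* K) :+ (b :* J :+ c :* K) :- a :* I) refl
          (chord ρ τ) (chord τ σ) (chord σ ρ) (sum (gap σ σ)) (sum (gap σ ρ)) (sum (gap σ τ))
          (five (core σ)) (core ρ) (core τ))
        (NonNeg-+ (NonNeg-resp (sum-combination (chord ρ τ) (chord τ σ) (chord σ ρ)
            (gap σ σ) (gap σ ρ) (gap σ τ))
            (NonNeg-sum _ λ i → NonNeg-resp (converted i)
              (casey {A = U σ} {U ρ} {U τ} (unit σ) (unit ρ) (unit τ)
                {c (high σ i) ⊖ c (low σ i)} ps (λ u unit-u →
                NonNeg-resp (sym (difference (low σ i) (high σ i) u))
                  (dominated≤ (low σ i) (high σ i) (low≤high σ i) u unit-u)))))
          (NonNeg-+ (NonNeg-* (chord-nonneg ρ τ ρ≢τ) (sum-gap-own σ))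
            (NonNeg-+ others others)))
        p
      where
      others = NonNeg-+
        (NonNeg-* (chord-nonneg τ σ (σ≢τ ∘ ≡.sym)) (sum-gap-other σ ρ σ≢ρ))
        (NonNeg-* (chord-nonneg σ ρ σ≢ρ) (sum-gap-other σ τ σ≢τ))
      g : Fin 5 → Tuple t → Carrier
      g i = support (c (high σ i) ⊖ c (low σ i)) (r (high σ i) - r (low σ i))
      diff = λ i u → difference (low σ i) (high σ i) u
      converted : ∀ i →
        ((chord τ σ * g i (U ρ) + chord σ ρ * g i (U τ)) +
         (chord τ σ * g i (U ρ) + chord σ ρ * g i (U τ))) - chord ρ τ * g i (U σ) ≈
        ((chord τ σ * gap σ ρ i + chord σ ρ * gap σ τ i) +
         (chord τ σ * gap σ ρ i + chord σ ρ * gap σ τ i)) - chord ρ τ * gap σ σ i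
      converted i = +-cong (+-cong inner inner) (-‿cong (*-congˡ (diff i (U σ))))
        where
        inner = +-cong (*-congˡ (diff i (U ρ))) (*-congˡ (diff i (U τ)))

    no-configuration : Empty.⊥
    no-configuration = chord-pos (# 1) (# 2) (λ ()) λ pk →
      contradict
        (Pos+NonNeg (Pos-* pk (core-pos (# 0)))
          (NonNeg-+ (NonNeg-* (chord-nonneg (# 2) (# 0) λ ()) (Pos⇒NonNeg (core-pos (# 1))))
                    (NonNeg-* (chord-nonneg (# 0) (# 1) λ ()) (Pos⇒NonNeg (core-pos (# 2))))))
        (NonNeg-+ (core-inequality (# 0) (# 1) (# 2) (λ ()) (λ ()) (λ ()))
          (NonNeg-+ (core-inequality (# 1) (# 2) (# 0) (λ ()) (λ ()) (λ ()))
                    (core-inequality (# 2) (# 0) (# 1) (λ ()) (λ ()) (λ ()))))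
        -- Each weighted range occurs with coefficient `2 + 2 - 5` in the sum of the three
        -- inequalities, which cancels the positive total.
        (trans (solve 6 (λ a b c I J K →
            let five = λ x → x :+ x :+ x :+ x :+ x in
            (a :* I :+ (b :* J :+ c :* K)) :+
            ((((b :* J :+ c :* K) :+ (b :* J :+ c :* K)) :- a :* five I) :+
            ((((c :* K :+ a :* I) :+ (c :* K :+ a :* I)) :- b :* five J) :+
             (((a :* I :+ b :* J) :+ (a :* I :+ b :* J)) :- c :* five K))) := con ℚ.0ℚ)
          refl (chord (# 1) (# 2)) (chord (# 2) (# 0)) (chord (# 0) (# 1))
               (core (# 0)) (core (# 1)) (core (# 2))) rational-zero)

  module _ {t} (c : Fin 33 → Tuple (ℕ.suc t)) (r : Fin 33 → Carrier) (r≥0 : ∀ x → NonNeg (r x))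
    (represents : ∀ Y x → x ∈ hull Y → ∀ p → InBall (c x) (r x) p →
                  InHull (λ p → ∃[ y ] (y ∈ Y × InBall (c y) (r y) p)) p)
    (separates : ∀ x y → ¬ (x ∈ hull ⁅ y ⁆) → ¬ (∀ p → InBall (c x) (r x) p → InBall (c y) (r y) p))
    where

    value : Fin 33 → Tuple (ℕ.suc t) → Carrier
    value x = support (c x) (r x)

    hullBound : ∀ x y z → (∀ σ → rank σ x ≤ rank σ y ⊎ rank σ x ≤ rank σ z) → ∀ u → Unit u → ∀ M →
      NonNeg (M - value y u) → NonNeg (M - value z u) → NonNeg (M - value x u)
    hullBound x y z below u unit M y≤M z≤M = inHull⇒support≤
      {S = λ p → ∃[ v ] (v ∈ ⁅ y ⁆ ∪ ⁅ z ⁆ × InBall (c v) (r v) p)} {c = c x} {M = M} {u} unit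
      (represents (⁅ y ⁆ ∪ ⁅ z ⁆) x (∈-hull-pair {x} {y} {z} below))
      λ q (v , v∈ , q∈) → NonNeg-transitive M (value v u) (dot u q)
        ([ (λ v∈y → ≡.subst (λ v → NonNeg (M - value v u)) (≡.sym (x∈⁅y⁆⇒x≡y y v∈y)) y≤M)
         , (λ v∈z → ≡.subst (λ v → NonNeg (M - value v u)) (≡.sym (x∈⁅y⁆⇒x≡y z v∈z)) z≤M)
         ]′ (x∈p∪q⁻ ⁅ y ⁆ ⁅ z ⁆ v∈))
        (ball≤support {c = c v} {u = u} {q} unit (r≥0 v) q∈)

    -- Without such a direction the support functions would place the ball of `bottom σ` inside that
    -- of `pivot σ`, although `bottom σ` is above the pivot in the order `σ`.
    separatingDirection : ∀ σ → ¬ ¬ (∃[ u ] (Unit u × Pos (value (bottom σ) u - value (pivot σ) u)))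
    separatingDirection σ none = separates (bottom σ) (pivot σ)
      (∉-hull-singleton {bottom σ} {pivot σ} σ (pivot<bottom σ))
      (support≤⇒ball⊆ {c = c (bottom σ)} {c (pivot σ)} (r≥0 (bottom σ))
        (λ u unit q → none (u , unit , Pos-swap (value (pivot σ) u) (value (bottom σ) u) q)))

    unrepresentable : Empty.⊥
    unrepresentable = separatingDirection zero λ (u₀ , unit₀ , pos₀) →
      separatingDirection (suc zero) λ (u₁ , unit₁ , pos₁) →
      separatingDirection (suc (suc zero)) λ (u₂ , unit₂ , pos₂) →
      no-configuration c r hullBound
        (λ { zero → u₀ ; (suc zero) → u₁ ; (suc (suc zero)) → u₂ })
        (λ { zero → unit₀ ; (suc zero) → unit₁ ; (suc (suc zero)) → unit₂ })
        (λ { zero → pos₀ ; (suc zero) → pos₁ ; (suc (suc zero)) → pos₂ })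

-- Sphere representations over the reals

module Field = StablyOrderedField Reals.field-ℝ
module Ball = Geometry Reals.field-ℝ
open Reals using (seq-add; seq-mul; seq-neg)

seq-sub : ∀ x y n → seq (x Field.- y) n ≡ seq x n ℚ.- seq y n
seq-sub x y n = ≡.trans (seq-add x (Reals.neg y) n) (≡.cong (seq x n ℚ.+_) (seq-neg y n))

-- Sums in the statement and sums of the opaque field are different terms, so they are compared
-- through their sequences.
seq-sum : ∀ {m} (v v′ : Fin m → ℝ) → (∀ i n → seq (v i) n ≡ seq (v′ i) n) →
          ∀ n → seq (sumℝ v) n ≡ seq (Ball.sum v′) n
seq-sum {ℕ.zero}  v v′ v≡ n = ≡.refl
seq-sum {ℕ.suc m} v v′ v≡ n = ≡.trans
  (≡.cong₂ ℚ._+_ (v≡ zero n) (seq-sum (v ∘ suc) (v′ ∘ suc) (v≡ ∘ suc) n))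
  (≡.sym (seq-add (v′ zero) (Ball.sum (v′ ∘ suc)) n))

seq-sqDist : ∀ {t} (p c : Point t) n → seq (sqDist p c) n ≡ seq (Ball.normSq (p Ball.⊖ c)) n
seq-sqDist p c = seq-sum _ (λ j → (p Ball.⊖ c) j Field.* (p Ball.⊖ c) j) λ j n → ≡.sym
  (≡.trans (seq-mul ((p Ball.⊖ c) j) ((p Ball.⊖ c) j) n)
    (≡.cong₂ ℚ._*_ (seq-sub (p j) (c j) n) (seq-sub (p j) (c j) n)))

CH⇒InHull : ∀ {t} (S S′ : Pred (Point t) 0ℓ) p → (∀ q → S q → S′ q) → CH S p → Ball.InHull S′ p
CH⇒InHull S S′ p S⊆S′ (m , q , w , q∈S , w≥0 , Σw≈1 , p≈) =
  m , q , w , (λ i → S⊆S′ (q i) (q∈S i)) ,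
  (λ i → Reals.≤⇒NonNeg {0ℝ} {w i} (w i) (λ n → ≡.sym (ℚP.+-identityʳ (seq (w i) n))) (w≥0 i)) ,
  Reals.≈-trans {Ball.sum w} {sumℝ w} {1ℝ}
    (Reals.pointwise {Ball.sum w} {sumℝ w} λ n → ≡.sym (seq-sum w w (λ _ _ → ≡.refl) n)) Σw≈1 ,
  λ j → Reals.≈-trans {p j} {sumℝ (λ i → w i *ℝ q i j)} {Ball.sum (λ i → w i Field.* q i j)} (p≈ j)
    (Reals.pointwise {sumℝ (λ i → w i *ℝ q i j)} {Ball.sum (λ i → w i Field.* q i j)}
      (seq-sum (λ i → w i *ℝ q i j) (λ i → w i Field.* q i j)
        (λ i n → ≡.sym (seq-mul (w i) (q i j) n))))

⊆CH : ∀ {t} (S : Pred (Point t) 0ℓ) p → S p → CH S p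
⊆CH S p p∈S = 1 , (λ _ → p) , (λ _ → 1ℝ) , (λ _ → p∈S) ,
  (λ _ ε 0<ε → 0 , λ _ _ → ℚP.+-mono-< (ℚP.positive⁻¹ ℚ.1ℚ) 0<ε) ,
  Reals.pointwise {1ℝ +ℝ 0ℝ} {1ℝ} (λ _ → ≡.refl) ,
  λ j → Reals.pointwise {p j} {1ℝ *ℝ p j +ℝ 0ℝ} λ n →
    ≡.sym (≡.trans (ℚP.+-identityʳ (ℚ.1ℚ ℚ.* seq (p j) n)) (ℚP.*-identityˡ (seq (p j) n)))

module _ {t} (S : Sphere t) where
  open Sphere S

  slack : Point t → ℝ
  slack p = radius Field.* radius Field.- Ball.normSq (p Ball.⊖ centre)

  seq-slack : ∀ p n → seq (slack p) n ≡ seq (radius *ℝ radius) n ℚ.- seq (sqDist p centre) n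
  seq-slack p n = ≡.trans (seq-sub (radius Field.* radius) (Ball.normSq (p Ball.⊖ centre)) n)
    (≡.cong₂ ℚ._-_ (seq-mul radius radius n) (≡.sym (seq-sqDist p centre n)))

  points⇒InBall : ∀ p → points S p → Ball.InBall centre radius p
  points⇒InBall p = Reals.≤⇒NonNeg {sqDist p centre} {radius *ℝ radius} (slack p) (seq-slack p)

  InBall⇒points : ∀ p → Ball.InBall centre radius p → points S p
  InBall⇒points p = Reals.NonNeg⇒≤ {sqDist p centre} {radius *ℝ radius} (slack p) (seq-slack p)

theorem3p1 : ∃[ n ] Σ[ G ∈ ConvexGeometry n ]
    HasConvexDimension G 3 ×
    (∀ (t : ℕ) → 1 ≤ t → ¬ RepresentableBySpheres G t)
theorem3p1 = 33 , geometry , convexDimension-3 , notRepresentable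
  where
  notRepresentable : ∀ t → 1 ≤ t → ¬ RepresentableBySpheres geometry t
  notRepresentable (ℕ.suc t) _ (S , _ , represents) = unrepresentable
    (λ x → Sphere.centre (S x)) (λ x → Sphere.radius (S x))
    (λ x → Reals.≤⇒NonNeg {0ℝ} {Sphere.radius (S x)} (Sphere.radius (S x))
      (λ n → ≡.sym (ℚP.+-identityʳ (seq (Sphere.radius (S x)) n))) (Sphere.radius≥0 (S x)))
    (λ Y x x∈ p p∈ → CH⇒InHull (union Y)
      (λ p → ∃[ y ] (y ∈ Y × Ball.InBall (Sphere.centre (S y)) (Sphere.radius (S y)) p)) p
      (λ q (y , y∈Y , q∈) → y , y∈Y , points⇒InBall (S y) q q∈)
      (Equivalence.to (represents Y x) x∈ {p} (InBall⇒points (S x) p p∈)))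
    -- A ball inside that of `y` lies in the convex hull for `⁅ y ⁆`, and the representation turns
    -- this into membership of `x` in `hull ⁅ y ⁆`.
    λ x y x∉ sub → x∉ (Equivalence.from (represents ⁅ y ⁆ x) λ {p} p∈ →
      ⊆CH (union ⁅ y ⁆) p (y , x∈⁅x⁆ y , InBall⇒points (S y) p (sub p (points⇒InBall (S x) p p∈))))
    where
    open Obstruction Reals.field-ℝ
    union : Subset 33 → Pred (Point (ℕ.suc t)) 0ℓ
    union Y p = ∃[ y ] (y ∈ Y × points (S y) p)
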